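{- The bounded adaptation problem is decidable for $\mathcal{E}_d^2$: there is an algorithm which, given an $\mathcal{E}_d^2$ process $P$, a finite set $M$ of $\mathcal{E}_d^2$ processes, a barb $e\in\{a,\overline a\mid a\in\mathcal N\}$ and $k\ge 1$, decides whether no $R\in\mathcal{BC}^M_P$ satisfies $R\Downarrow^k_e$.
   Context: Fix a countably infinite set $\mathcal N$ of names. Prefixes are $\pi ::= a \mid \overline{a} \mid \widetilde{a}\{U\}$. Processes: $P ::= a[P] \mid P\parallel P \mid \sum_{i\in I}\pi_i.P_i \mid\ !\pi.P$ with $I$ finite ($\mathbf 0$ is the empty sum). A process is in $\mathcal E_d^2$ if every update pattern $U$ occurring in it (at any depth) is generated by $U::= P\mid a[U]\mid U\parallel U\mid\bullet$ where $P$ is a hole-free $\mathcal E_d^2$ process (so no hole occurs in the scope of a prefix). $U\{Q\}$ replaces each hole of $U$ not inside an update prefix by $Q$. Semantics (dynamic LTS). Labels $\alpha::= a\mid\overline a\mid a[P]\mid\widetilde a\{U\}\mid\tau$; $\star$ a fresh placeholder. Rules: $a[P]\xrightarrow{a[P]}\star$; $\sum_{i\in I}\pi_i.P_i\xrightarrow{\pi_j}P_j$; $!\pi.P\xrightarrow{\pi}P\parallel!\pi.P$; if $P\xrightarrow\alpha P'$ then $a[P]\xrightarrow\alpha a[P']$; if $P_1\xrightarrow\alpha P_1'$ then $P_1\parallel P_2\xrightarrow\alpha P_1'\parallel P_2$ and $P_2\parallel P_1\xrightarrow\alpha P_2\parallel P_1'$; if $P_1\xrightarrow a P_1'$ and $P_2\xrightarrow{\overline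 a}P_2'$ then $P_1\parallel P_2\xrightarrow\tau P_1'\parallel P_2'$ (and symmetrically); if $P_1\xrightarrow{a[Q]}P_1'$ and $P_2\xrightarrow{\widetilde a\{U\}}P_2'$ then $P_1\parallel P_2\xrightarrow\tau P_1'[U\{Q\}/\star]\parallel P_2'$ (and symmetrically). $P\to P'$ means $P\xrightarrow\tau P'$. $P\downarrow_\alpha$ iff $P\xrightarrow\alpha P'$ for some $P'$; $P\Downarrow^k_\alpha$ iff there exist $Q_1,\dots,Q_k$ with $P\to^*Q_1\to Q_2\to\cdots\to Q_k$ and $Q_i\downarrow_\alpha$ for all $i$. For $M=\{P_1,\dots,P_n\}$, $\mathcal{BC}^M_P=\{P\parallel\prod^{m_1}P_1\parallel\cdots\parallel\prod^{m_n}P_n\mid m_i\in\mathbb N\}$, where $\prod^m Q$ denotes $m$ parallel copies of $Q$. -}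

module Defs where

open import Data.Nat using (ℕ; zero; suc)
open import Data.Fin using (Fin; zero; suc)
open import Data.List using (List; []; _∷_; _++_; replicate; length)
open import Data.List.Membership.Propositional using (_∈_)
open import Data.Product using (_×_; _,_; ∃)
open import Function using (_∘_)
open import Relation.Binary.PropositionalEquality using (_≡_)
open import Relation.Binary.Construct.Closure.ReflexiveTransitive using (Star)

Name : Set
Name = ℕ

-- Syntax. A single datatype covers processes and update patterns:
--   hole  is the hole • of update patterns,
--   star  is the placeholder ★ used by the LTS.
-- Processes proper are the terms containing neither (see Ed2 below).
data Proc : Set
data Pref : Set

data Proc where
  hole : Proc
  star : Proc
  loc  : Name → Proc → Proc
  _∥_  : Proc → Proc → Proc
  sum  : List (Pref × Proc) → Proc
  rep  : Pref → Proc → Proc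

data Pref where
  inp : Name → Pref
  out : Name → Pref
  upd : Name → Proc → Pref

nil : Proc
nil = sum []

data Ed2 : Proc → Set
data Ed2Pref : Pref → Set
data Ed2Pat : Proc → Set
data Ed2Sum : List (Pref × Proc) → Set

data Ed2 where
  loc : ∀ {a P} → Ed2 P → Ed2 (loc a P)
  par : ∀ {P Q} → Ed2 P → Ed2 Q → Ed2 (P ∥ Q)
  sum : ∀ {ps} → Ed2Sum ps → Ed2 (sum ps)
  rep : ∀ {π P} → Ed2Pref π → Ed2 P → Ed2 (rep π P)

data Ed2Sum where
  []  : Ed2Sum []
  _∷_ : ∀ {π P ps} → Ed2Pref π × Ed2 P → Ed2Sum ps → Ed2Sum ((π , P) ∷ ps)

data Ed2Pref where
  inp : ∀ {a} → Ed2Pref (inp a)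
  out : ∀ {a} → Ed2Pref (out a)
  upd : ∀ {a U} → Ed2Pat U → Ed2Pref (upd a U)

data Ed2Pat where
  proc : ∀ {P} → Ed2 P → Ed2Pat P
  hole : Ed2Pat hole
  loc  : ∀ {a U} → Ed2Pat U → Ed2Pat (loc a U)
  par  : ∀ {U V} → Ed2Pat U → Ed2Pat V → Ed2Pat (U ∥ V)

fillHole : Proc → Proc → Proc
fillHoleL : List (Pref × Proc) → Proc → List (Pref × Proc)
fillHole hole Q = Q
fillHole star Q = star
fillHole (loc a U) Q = loc a (fillHole U Q)
fillHole (U ∥ V) Q = fillHole U Q ∥ fillHole V Q
fillHole (sum ps) Q = sum (fillHoleL ps Q)
fillHole (rep π U) Q = rep π (fillHole U Q)
fillHoleL [] Q = []
fillHoleL ((π , U) ∷ ps) Q = (π , fillHole U Q) ∷ fillHoleL ps Q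

fillStar : Proc → Proc → Proc
fillStarL : List (Pref × Proc) → Proc → List (Pref × Proc)
fillStar hole R = hole
fillStar star R = R
fillStar (loc a P) R = loc a (fillStar P R)
fillStar (P ∥ Q) R = fillStar P R ∥ fillStar Q R
fillStar (sum ps) R = sum (fillStarL ps R)
fillStar (rep π P) R = rep π (fillStar P R)
fillStarL [] R = []
fillStarL ((π , P) ∷ ps) R = (π , fillStar P R) ∷ fillStarL ps R

data Label : Set where
  lin  : Name → Label
  lout : Name → Label
  lloc : Name → Proc → Label
  lupd : Name → Proc → Label
  τ    : Label

prefLabel : Pref → Label
prefLabel (inp a) = lin a
prefLabel (out a) = lout a
prefLabel (upd a U) = lupd a U

data _─[_]→_ : Proc → Label → Proc → Set where
  locOut : ∀ {a P} → loc a P ─[ lloc a P ]→ star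
  sumAct : ∀ {ps π P} → (π , P) ∈ ps → sum ps ─[ prefLabel π ]→ P
  repAct : ∀ {π P} → rep π P ─[ prefLabel π ]→ (P ∥ rep π P)
  locIn  : ∀ {a P P' α} → P ─[ α ]→ P' → loc a P ─[ α ]→ loc a P'
  parL   : ∀ {P₁ P₁' P₂ α} → P₁ ─[ α ]→ P₁' → (P₁ ∥ P₂) ─[ α ]→ (P₁' ∥ P₂)
  parR   : ∀ {P₁ P₁' P₂ α} → P₁ ─[ α ]→ P₁' → (P₂ ∥ P₁) ─[ α ]→ (P₂ ∥ P₁')
  syncL  : ∀ {a P₁ P₁' P₂ P₂'} → P₁ ─[ lin a ]→ P₁' → P₂ ─[ lout a ]→ P₂' →
           (P₁ ∥ P₂) ─[ τ ]→ (P₁' ∥ P₂')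
  syncR  : ∀ {a P₁ P₁' P₂ P₂'} → P₁ ─[ lin a ]→ P₁' → P₂ ─[ lout a ]→ P₂' →
           (P₂ ∥ P₁) ─[ τ ]→ (P₂' ∥ P₁')
  updL   : ∀ {a Q U P₁ P₁' P₂ P₂'} → P₁ ─[ lloc a Q ]→ P₁' → P₂ ─[ lupd a U ]→ P₂' →
           (P₁ ∥ P₂) ─[ τ ]→ (fillStar P₁' (fillHole U Q) ∥ P₂')
  updR   : ∀ {a Q U P₁ P₁' P₂ P₂'} → P₁ ─[ lloc a Q ]→ P₁' → P₂ ─[ lupd a U ]→ P₂' →
           (P₂ ∥ P₁) ─[ τ ]→ (P₂' ∥ fillStar P₁' (fillHole U Q))

_⟶_ : Proc → Proc → Set
P ⟶ P' = P ─[ τ ]→ P'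

_⟶*_ : Proc → Proc → Set
_⟶*_ = Star _⟶_

data Barb : Set where
  bin  : Name → Barb
  bout : Name → Barb

barbLabel : Barb → Label
barbLabel (bin a) = lin a
barbLabel (bout a) = lout a

_↓_ : Proc → Label → Set
P ↓ α = ∃ λ P' → P ─[ α ]→ P'

data Chain (e : Barb) : ℕ → Proc → Set where
  done : ∀ {Q} → Chain e zero Q
  last : ∀ {Q} → Q ↓ barbLabel e → Chain e (suc zero) Q
  step : ∀ {k Q Q'} → Q ↓ barbLabel e → Q ⟶ Q' → Chain e (suc k) Q' →
         Chain e (suc (suc k)) Q

WeakBarb : Proc → Barb → ℕ → Set
WeakBarb P e k = ∃ λ Q → P ⟶* Q × Chain e k Q

copies : (M : List Proc) → (Fin (length M) → ℕ) → List Proc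
copies [] ms = []
copies (Q ∷ M) ms = replicate (ms zero) Q ++ copies M (ms ∘ suc)

parAll : Proc → List Proc → Proc
parAll P [] = P
parAll P (Q ∷ Qs) = parAll (P ∥ Q) Qs

InBC : Proc → List Proc → Proc → Set
InBC P M R = ∃ λ (ms : Fin (length M) → ℕ) → R ≡ parAll P (copies M ms)

{-# OPTIONS --safe #-}

-- Hole-free processes are trees with leaves (sums and replications) and location names
-- drawn from a finite set, which reduction does not enlarge.  Homeomorphic embedding is a
-- simulation on them, so the processes reaching a k-chain within n steps form an
-- upward-closed set.  Every process in it embeds one of weight at most c + 3n in the same
-- set, so its minimal elements can be listed, and Kruskal's theorem makes the increasing
-- sequence of these sets stationary.  What remains is to decide which of finitely many
-- processes embed into an extension of P by copies of elements of M.
--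
-- Kruskal's theorem is used in the form "bad sequences are well-founded", which for
-- decidable relations needs neither Ramsey's theorem nor minimal bad sequences: the trees
-- avoiding a given tree t reflect into trees over a simpler signature.

module Submission where

open import Defs
open import Data.Bool using (Bool; true; false; T)
open import Data.Empty using (⊥-elim)
open import Data.Fin using (zero; suc)
open import Data.List using
  (List; []; _∷_; _++_; cartesianProductWith; concat; concatMap; map; replicate)
open import Data.List.Membership.Propositional using (_∈_; find; lose; mapWith∈)
open import Data.List.Membership.Propositional.Properties
open import Data.List.Relation.Binary.Subset.Propositional using (_⊆_)
open import Data.List.Relation.Unary.All as All using (All; []; _∷_)
open import Data.List.Relation.Unary.All.Properties using (++⁺; replicate⁺)
open import Data.List.Relation.Unary.Any as Any using (Any; here; there; any?)
open import Data.List.Relation.Unary.Any.Properties using (mapWith∈⁺)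
open import Data.Maybe using (Maybe; just; nothing)
open import Data.Nat using (ℕ; zero; suc; _+_; _≤_; z≤n; s≤s)
import Data.Nat as ℕ
open import Data.Nat.Properties hiding (_≟_)
open import Data.Nat.Tactic.RingSolver using (solve-∀)
open import Data.Product using (∃; _×_; _,_; proj₁; proj₂)
open import Data.Product.Relation.Binary.Pointwise.NonDependent as × using ()
open import Data.Sum using (_⊎_; inj₁; inj₂; [_,_]′)
open import Data.Sum.Relation.Binary.Pointwise as ⊎ using (inj₁; inj₂)
open import Data.Unit using (⊤; tt)
open import Function using (_∘_; case_of_)
open import Relation.Binary using (Decidable; DecidableEquality)
open import Relation.Binary.Construct.Closure.ReflexiveTransitive using (ε; _◅_)
open import Relation.Binary.PropositionalEquality using
  (_≡_; refl; sym; trans; cong; cong₂; subst)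
open import Relation.Nullary using (Dec; yes; no; ¬_; ¬?; _×-dec_; _⊎-dec_; map′)

-- Kruskal's theorem for trees of branching at most two

-- Accessibility of bad sequences. `P` is what a bad sequence may still use; choosing `x` removes
-- everything above `x`, so no history of chosen elements has to be kept.
data WQ {A : Set} (R : A → A → Set) (P : A → Set) : Set where
  wq : (∀ {x} → P x → WQ R (λ y → P y × ¬ R x y)) → WQ R P

-- Bad sequences for `R` translate into bad sequences for `S`. `F` is a relation because the image
-- may depend on the evidence for `P x`.
wq-reflect : ∀ {A B : Set} {R : A → A → Set} {S : B → B → Set} {P : A → Set} {Q : B → Set}
             (F : A → B → Set) →
             (∀ {x} → P x → ∃ λ x′ → F x x′ × Q x′) →
             (∀ {x y x′ y′} → F x x′ → F y y′ → S x′ y′ → R x y) →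
             WQ S Q → WQ R P
wq-reflect F total reflects (wq w) = wq λ p →
  let (_ , f , q) = total p in
  wq-reflect F
    (λ (p′ , ¬r) → let (_ , f′ , q′) = total p′ in
                   _ , f′ , q′ , λ s → ¬r (reflects f f′ s))
    reflects (w q)

module _ {A : Set} {R : A → A → Set} where

  wq-⊆ : ∀ {P Q : A → Set} → (∀ {x} → P x → Q x) → WQ R Q → WQ R P
  wq-⊆ P⊆Q = wq-reflect _≡_ (λ p → _ , refl , P⊆Q p) λ { refl refl r → r }

  -- A chosen element shrinks its own half, and the restriction it puts on the other half is
  -- forgotten, so one of the two proofs always decreases.
  wq-∪ : ∀ {P Q : A → Set} → WQ R P → WQ R Q → WQ R (λ x → P x ⊎ Q x)
  wq-∪ v@(wq f) w@(wq g) = wq λ where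
    (inj₁ p) → wq-⊆ (λ { (inj₁ p′ , ¬r) → inj₁ (p′ , ¬r) ; (inj₂ q′ , _) → inj₂ q′ }) (wq-∪ (f p) w)
    (inj₂ q) → wq-⊆ (λ { (inj₁ p′ , _) → inj₁ p′ ; (inj₂ q′ , ¬r) → inj₂ (q′ , ¬r) }) (wq-∪ v (g q))

wq-∈ : ∀ {A : Set} (xs : List A) → WQ _≡_ (_∈ xs)
wq-∈ [] = wq λ ()
wq-∈ (x ∷ xs) = wq-⊆ (λ { (here eq) → inj₁ eq ; (there i) → inj₂ i })
  (wq-∪ (wq λ { refl → wq λ { (refl , x≢x) → ⊥-elim (x≢x refl) } }) (wq-∈ xs))

module _ {A B : Set} {R : A → A → Set} {S : B → B → Set} where

  wq-⊎ : ∀ {P : A → Set} {Q : B → Set} → WQ R P → WQ S Q →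
         WQ (⊎.Pointwise R S) [ P , Q ]′
  wq-⊎ v w = wq-⊆ (λ { {inj₁ _} p → inj₁ (_ , refl , p) ; {inj₂ _} q → inj₂ (_ , refl , q) })
    (wq-∪ (wq-reflect (λ x a → x ≡ inj₁ a) (λ p → p) (λ { refl refl r → inj₁ r }) v)
          (wq-reflect (λ x b → x ≡ inj₂ b) (λ q → q) (λ { refl refl s → inj₂ s }) w))

  -- A pair not above `(a , b)` fails in the first or in the second coordinate. Deciding `R` tells
  -- which, and each alternative shrinks one factor.
  wq-× : ∀ {P : A → Set} {Q : B → Set} → Decidable R → WQ R P → WQ S Q →
         WQ (×.Pointwise R S) (λ (a , b) → P a × Q b)
  wq-× {P} {Q} R? v@(wq f) w@(wq g) = wq λ { {a , b} (p , q) →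
    wq-⊆ (split a) (wq-∪ (wq-× R? (f p) w) (wq-× R? v (g q))) }
    where
    split : ∀ a {b} {(a′ , b′) : A × B} → (P a′ × Q b′) × ¬ (R a a′ × S b b′) →
            ((P a′ × ¬ R a a′) × Q b′) ⊎ (P a′ × (Q b′ × ¬ S b b′))
    split a {_} {a′ , _} ((p , q) , ¬rs) with R? a a′
    ... | yes r = inj₂ (p , q , λ s → ¬rs (r , s))
    ... | no ¬r = inj₁ ((p , ¬r) , q)

data Tree (A B : Set) : Set where
  leaf : B → Tree A B
  una  : A → Tree A B → Tree A B
  bin  : Tree A B → Tree A B → Tree A B

-- The flag switches binary nodes on or off. The unary trees obtained with `false` are the simpler
-- class to which trees avoiding a binary root are reduced.
data Over {A B : Set} (branching : Bool) (P : A → Set) (Q : B → Set) : Tree A B → Set where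
  leaf : ∀ {b} → Q b → Over branching P Q (leaf b)
  una  : ∀ {a t} → P a → Over branching P Q t → Over branching P Q (una a t)
  bin  : ∀ {t u} → T branching → Over branching P Q t → Over branching P Q u →
         Over branching P Q (bin t u)

data Emb {A B : Set} (R : A → A → Set) (S : B → B → Set) : Tree A B → Tree A B → Set where
  leaf  : ∀ {b b′} → S b b′ → Emb R S (leaf b) (leaf b′)
  una   : ∀ {a a′ t t′} → R a a′ → Emb R S t t′ → Emb R S (una a t) (una a′ t′)
  bin   : ∀ {t t′ u u′} → Emb R S t t′ → Emb R S u u′ → Emb R S (bin t u) (bin t′ u′)
  below : ∀ {a t t′} → Emb R S t t′ → Emb R S t (una a t′)
  left  : ∀ {t t′ u} → Emb R S t t′ → Emb R S t (bin t′ u)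
  right : ∀ {t t′ u} → Emb R S t t′ → Emb R S t (bin u t′)

-- In a tree avoiding una a s, the argument of a root una b with R a b avoids s, so the node
-- can be collapsed to a leaf carrying b and that argument.
data CutUna {A B : Set} : Tree A B → Tree A (B ⊎ (A × Tree A B)) → Set where
  leaf : ∀ {b} → CutUna (leaf b) (leaf (inj₁ b))
  cut  : ∀ {a t} → CutUna (una a t) (leaf (inj₂ (a , t)))
  una  : ∀ {a t t′} → CutUna t t′ → CutUna (una a t) (una a t′)
  bin  : ∀ {t t′ u u′} → CutUna t t′ → CutUna u u′ → CutUna (bin t u) (bin t′ u′)

-- In a tree avoiding bin s₁ s₂, one argument of each binary node avoids s₁ or s₂, so it can
-- be absorbed into a label, leaving the other argument under a unary node.
data CutBin {A B : Set} : Tree A B → Tree (A ⊎ (Tree A B ⊎ Tree A B)) B → Set where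
  leaf     : ∀ {b} → CutBin (leaf b) (leaf b)
  una      : ∀ {a t t′} → CutBin t t′ → CutBin (una a t) (una (inj₁ a) t′)
  cutLeft  : ∀ {t u u′} → CutBin u u′ → CutBin (bin t u) (una (inj₂ (inj₁ t)) u′)
  cutRight : ∀ {t t′ u} → CutBin t t′ → CutBin (bin t u) (una (inj₂ (inj₂ u)) t′)

module _ {A B : Set} {R : A → A → Set} {S : B → B → Set} where

  cutUna-reflects : ∀ {t u t′ u′} → CutUna t t′ → CutUna u u′ →
    Emb R (⊎.Pointwise S (×.Pointwise R (Emb R S))) t′ u′ → Emb R S t u
  cutUna-reflects leaf leaf (leaf (inj₁ s)) = leaf s
  cutUna-reflects leaf cut (leaf ())
  cutUna-reflects cut leaf (leaf ())
  cutUna-reflects cut cut (leaf (inj₂ (r , e))) = una r e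
  cutUna-reflects (una c) (una d) (una r e) = una r (cutUna-reflects c d e)
  cutUna-reflects (bin c c′) (bin d d′) (bin e e′) =
    bin (cutUna-reflects c d e) (cutUna-reflects c′ d′ e′)
  cutUna-reflects c (una d) (below e) = below (cutUna-reflects c d e)
  cutUna-reflects c (bin d _) (left e) = left (cutUna-reflects c d e)
  cutUna-reflects c (bin _ d) (right e) = right (cutUna-reflects c d e)

  cutBin-reflects : ∀ {t u t′ u′} → CutBin t t′ → CutBin u u′ →
    Emb (⊎.Pointwise R (⊎.Pointwise (Emb R S) (Emb R S))) S t′ u′ → Emb R S t u
  cutBin-reflects leaf leaf (leaf s) = leaf s
  cutBin-reflects (una c) (una d) (una (inj₁ r) e) = una r (cutBin-reflects c d e)
  cutBin-reflects (cutLeft c) (cutLeft d) (una (inj₂ (inj₁ f)) e) = bin f (cutBin-reflects c d e)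
  cutBin-reflects (cutRight c) (cutRight d) (una (inj₂ (inj₂ f)) e) = bin (cutBin-reflects c d e) f
  cutBin-reflects (cutLeft _) (cutRight _) (una (inj₂ ()) _)
  cutBin-reflects (cutRight _) (cutLeft _) (una (inj₂ ()) _)
  cutBin-reflects c (una d) (below e) = below (cutBin-reflects c d e)
  cutBin-reflects c (cutLeft d) (below e) = right (cutBin-reflects c d e)
  cutBin-reflects c (cutRight d) (below e) = left (cutBin-reflects c d e)

  -- A single leaf embeds as soon as one leaf label lies above it, so avoiding it restricts the leaf
  -- labels only.
  over-leaf : ∀ {branching P Q b t} →
    Over branching P Q t × ¬ Emb R S (leaf b) t → Over branching P (λ c → Q c × ¬ S b c) t
  over-leaf (leaf q , ¬e) = leaf (q , ¬e ∘ leaf)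
  over-leaf (una p o , ¬e) = una p (over-leaf (o , ¬e ∘ below))
  over-leaf (bin β o o′ , ¬e) = bin β (over-leaf (o , ¬e ∘ left)) (over-leaf (o′ , ¬e ∘ right))

module _ {A B : Set} {R : A → A → Set} {S : B → B → Set}
         (R? : Decidable R) (S? : Decidable S) where

  emb? : Decidable (Emb R S)
  emb? (leaf b) (leaf b′) = map′ leaf (λ { (leaf s) → s }) (S? b b′)
  emb? (leaf b) (una _ t) = map′ below (λ { (below e) → e }) (emb? (leaf b) t)
  emb? (leaf b) (bin t u) = map′ [ left , right ]′ (λ { (left e) → inj₁ e ; (right e) → inj₂ e })
    (emb? (leaf b) t ⊎-dec emb? (leaf b) u)
  emb? (una a t) (leaf _) = no λ ()
  emb? (una a t) (una a′ t′) =
    map′ [ (λ (r , e) → una r e) , below ]′ (λ { (una r e) → inj₁ (r , e) ; (below e) → inj₂ e })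
    ((R? a a′ ×-dec emb? t t′) ⊎-dec emb? (una a t) t′)
  emb? (una a t) (bin t′ u′) = map′ [ left , right ]′ (λ { (left e) → inj₁ e ; (right e) → inj₂ e })
    (emb? (una a t) t′ ⊎-dec emb? (una a t) u′)
  emb? (bin t u) (leaf _) = no λ ()
  emb? (bin t u) (una _ t′) = map′ below (λ { (below e) → e }) (emb? (bin t u) t′)
  emb? (bin t u) (bin t′ u′) =
    map′ [ (λ (e , f) → bin e f) , [ left , right ]′ ]′
         (λ { (bin e f) → inj₁ (e , f) ; (left e) → inj₂ (inj₁ e) ; (right e) → inj₂ (inj₂ e) })
    ((emb? t t′ ×-dec emb? u u′) ⊎-dec (emb? (bin t u) t′ ⊎-dec emb? (bin t u) u′))

  -- Cutting at the topmost unary labels above `a` leaves only labels not above `a`. The leaf labels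
  -- grow, but only by trees that avoid the smaller tree `s`.
  cutUna : ∀ {branching P Q} a s {t} → Over branching P Q t × ¬ Emb R S (una a s) t →
    ∃ λ t′ → CutUna t t′ ×
      Over branching (λ b → P b × ¬ R a b)
        [ Q , (λ (b , u) → P b × Over branching P Q u × ¬ Emb R S s u) ]′ t′
  cutUna a s (leaf q , _) = _ , leaf , leaf q
  cutUna a s (una {b} p o , ¬e) with R? a b
  ... | yes r = _ , cut , leaf (p , o , λ e → ¬e (una r e))
  ... | no ¬r = let (_ , c , o′) = cutUna a s (o , ¬e ∘ below) in _ , una c , una (p , ¬r) o′
  cutUna a s (bin β o o′ , ¬e) =
    let (_ , c , v)   = cutUna a s (o , ¬e ∘ left)
        (_ , c′ , v′) = cutUna a s (o′ , ¬e ∘ right)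
    in _ , bin c c′ , bin β v v′

  cutBin : ∀ {branching P Q} s₁ s₂ {t} → Over branching P Q t × ¬ Emb R S (bin s₁ s₂) t →
    ∃ λ t′ → CutBin t t′ ×
      Over false [ P , [ (λ u → Over branching P Q u × ¬ Emb R S s₁ u) ,
                         (λ u → Over branching P Q u × ¬ Emb R S s₂ u) ]′ ]′ Q t′
  cutBin s₁ s₂ (leaf q , _) = _ , leaf , leaf q
  cutBin s₁ s₂ (una p o , ¬e) =
    let (_ , c , v) = cutBin s₁ s₂ (o , ¬e ∘ below) in _ , una c , una p v
  -- If `s₁` embeds on the left, then `s₂` cannot embed on the right, so one of the two arguments
  -- can always be absorbed.
  cutBin s₁ s₂ (bin {t} _ o o′ , ¬e) with emb? s₁ t
  ... | no ¬f = let (_ , c , v) = cutBin s₁ s₂ (o′ , ¬e ∘ right) in _ , cutLeft c , una (o , ¬f) v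
  ... | yes f = let (_ , c , v) = cutBin s₁ s₂ (o , ¬e ∘ left)
                in _ , cutRight c , una (o′ , λ g → ¬e (bin f g)) v

WQTree : Bool → Set₁
WQTree branching = ∀ {A B : Set} {R : A → A → Set} {S : B → B → Set} {P Q} →
  Decidable R → Decidable S → WQ R P → WQ S Q → WQ (Emb R S) (Over branching P Q)

module _ {branching : Bool} (wq-unbranched : T branching → WQTree false) where

  mutual
    wq-tree-step : WQTree branching
    wq-tree-step R? S? v w = wq (wq-avoiding R? S? v w)

    -- Lexicographic induction on `v`, then `w`, then the derivation for the avoided tree. A leaf
    -- decreases `w`; a unary root decreases `v` at the price of richer leaf labels; a binary root
    -- passes to unary trees.
    wq-avoiding : ∀ {A B : Set} {R : A → A → Set} {S : B → B → Set} {P Q} →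
                  Decidable R → Decidable S → WQ R P → WQ S Q →
                  ∀ {t} → Over branching P Q t →
                  WQ (Emb R S) (λ u → Over branching P Q u × ¬ Emb R S t u)
    wq-avoiding R? S? v (wq g) (leaf q) =
      wq-⊆ over-leaf (wq-tree-step R? S? v (g q))
    wq-avoiding R? S? v@(wq f) w (una {a} {s} p o) =
      wq-reflect CutUna (cutUna R? S? a s) cutUna-reflects
        (wq-tree-step R? (⊎.⊎-decidable S? (×.×-decidable R? (emb? R? S?))) (f p)
          (wq-⊎ w (wq-× R? v (wq-avoiding R? S? v w o))))
    wq-avoiding R? S? v w (bin {s₁} {s₂} β o₁ o₂) =
      wq-reflect CutBin (cutBin R? S? s₁ s₂) cutBin-reflects
        (wq-unbranched β (⊎.⊎-decidable R? (⊎.⊎-decidable (emb? R? S?) (emb? R? S?))) S?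
          (wq-⊎ v (wq-⊎ (wq-avoiding R? S? v w o₁) (wq-avoiding R? S? v w o₂))) w)

wq-tree : WQTree true
-- The inner instance treats unary trees, where `T false` is empty and the hypothesis holds
-- vacuously.
wq-tree = wq-tree-step λ _ → wq-tree-step λ ()

-- Reduction without the placeholder

-- The generators of processes: location names, and leaves, that is, sums and replications taken as
-- indivisible.
Atom : Set
Atom = Name ⊎ Proc

mutual
  _≟_ : DecidableEquality Proc
  hole ≟ hole = yes refl
  hole ≟ star = no λ ()
  hole ≟ loc _ _ = no λ ()
  hole ≟ (_ ∥ _) = no λ ()
  hole ≟ sum _ = no λ ()
  hole ≟ rep _ _ = no λ ()
  star ≟ hole = no λ ()
  star ≟ star = yes refl
  star ≟ loc _ _ = no λ ()
  star ≟ (_ ∥ _) = no λ ()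
  star ≟ sum _ = no λ ()
  star ≟ rep _ _ = no λ ()
  loc _ _ ≟ hole = no λ ()
  loc _ _ ≟ star = no λ ()
  loc a P ≟ loc b Q =
    map′ (λ { (refl , refl) → refl }) (λ { refl → refl , refl }) (a ℕ.≟ b ×-dec P ≟ Q)
  loc _ _ ≟ (_ ∥ _) = no λ ()
  loc _ _ ≟ sum _ = no λ ()
  loc _ _ ≟ rep _ _ = no λ ()
  (_ ∥ _) ≟ hole = no λ ()
  (_ ∥ _) ≟ star = no λ ()
  (_ ∥ _) ≟ loc _ _ = no λ ()
  (P ∥ P′) ≟ (Q ∥ Q′) =
    map′ (λ { (refl , refl) → refl }) (λ { refl → refl , refl }) (P ≟ Q ×-dec P′ ≟ Q′)
  (_ ∥ _) ≟ sum _ = no λ ()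
  (_ ∥ _) ≟ rep _ _ = no λ ()
  sum _ ≟ hole = no λ ()
  sum _ ≟ star = no λ ()
  sum _ ≟ loc _ _ = no λ ()
  sum _ ≟ (_ ∥ _) = no λ ()
  sum ps ≟ sum qs = map′ (cong sum) (λ { refl → refl }) (ps ≟-sum qs)
  sum _ ≟ rep _ _ = no λ ()
  rep _ _ ≟ hole = no λ ()
  rep _ _ ≟ star = no λ ()
  rep _ _ ≟ loc _ _ = no λ ()
  rep _ _ ≟ (_ ∥ _) = no λ ()
  rep _ _ ≟ sum _ = no λ ()
  rep π P ≟ rep ρ Q =
    map′ (λ { (refl , refl) → refl }) (λ { refl → refl , refl }) (π ≟-pref ρ ×-dec P ≟ Q)

  _≟-pref_ : DecidableEquality Pref
  inp a ≟-pref inp b = map′ (cong inp) (λ { refl → refl }) (a ℕ.≟ b)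
  inp _ ≟-pref out _ = no λ ()
  inp _ ≟-pref upd _ _ = no λ ()
  out _ ≟-pref inp _ = no λ ()
  out a ≟-pref out b = map′ (cong out) (λ { refl → refl }) (a ℕ.≟ b)
  out _ ≟-pref upd _ _ = no λ ()
  upd _ _ ≟-pref inp _ = no λ ()
  upd _ _ ≟-pref out _ = no λ ()
  upd a U ≟-pref upd b V =
    map′ (λ { (refl , refl) → refl }) (λ { refl → refl , refl }) (a ℕ.≟ b ×-dec U ≟ V)

  _≟-sum_ : DecidableEquality (List (Pref × Proc))
  [] ≟-sum [] = yes refl
  [] ≟-sum (_ ∷ _) = no λ ()
  (_ ∷ _) ≟-sum [] = no λ ()
  ((π , P) ∷ ps) ≟-sum ((ρ , Q) ∷ qs) =
    map′ (λ { (refl , refl , refl) → refl }) (λ { refl → refl , refl , refl })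
      (π ≟-pref ρ ×-dec (P ≟ Q ×-dec ps ≟-sum qs))

data Act : Proc → Pref → Proc → Set where
  sum : ∀ {ps π P} → (π , P) ∈ ps → Act (sum ps) π P
  rep : ∀ {π P} → Act (rep π P) π (P ∥ rep π P)
  loc : ∀ {a π P P′} → Act P π P′ → Act (loc a P) π (loc a P′)
  parL : ∀ {π P P′ Q} → Act P π P′ → Act (P ∥ Q) π (P′ ∥ Q)
  parR : ∀ {π P Q Q′} → Act Q π Q′ → Act (P ∥ Q) π (P ∥ Q′)

-- Fuses the transition a[Q] with the substitution of R for the placeholder it leaves.
data Replace (a : Name) (Q R : Proc) : Proc → Proc → Set where
  here : Replace a Q R (loc a Q) R
  loc  : ∀ {b P P′} → Replace a Q R P P′ → Replace a Q R (loc b P) (loc b P′)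
  parL : ∀ {P P′ S} → Replace a Q R P P′ → Replace a Q R (P ∥ S) (P′ ∥ S)
  parR : ∀ {P S S′} → Replace a Q R S S′ → Replace a Q R (P ∥ S) (P ∥ S′)

data Interact : Proc → Proc → Proc → Proc → Set where
  sync   : ∀ {a P P′ Q Q′} → Act P (inp a) P′ → Act Q (out a) Q′ → Interact P P′ Q Q′
  update : ∀ {a S U P P′ Q Q′} → Replace a S (fillHole U S) P P′ → Act Q (upd a U) Q′ →
           Interact P P′ Q Q′

data Red : Proc → Proc → Set where
  loc   : ∀ {a P P′} → Red P P′ → Red (loc a P) (loc a P′)
  parL  : ∀ {P P′ Q} → Red P P′ → Red (P ∥ Q) (P′ ∥ Q)
  parR  : ∀ {P Q Q′} → Red Q Q′ → Red (P ∥ Q) (P ∥ Q′)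
  commL : ∀ {P P′ Q Q′} → Interact P P′ Q Q′ → Red (P ∥ Q) (P′ ∥ Q′)
  commR : ∀ {P P′ Q Q′} → Interact P P′ Q Q′ → Red (Q ∥ P) (Q′ ∥ P′)

-- After a location output the residual still contains the placeholder, so that case speaks of every
-- possible filling `R`.
Spec : Proc → Label → Proc → Set
Spec P (lin a) P′ = Act P (inp a) P′
Spec P (lout a) P′ = Act P (out a) P′
Spec P (lloc a Q) P′ = ∀ R → Replace a Q R P (fillStar P′ R)
Spec P (lupd a U) P′ = Act P (upd a U) P′
Spec P τ P′ = Red P P′

act-sound : ∀ {P π P′} → Act P π P′ → P ─[ prefLabel π ]→ P′
act-sound (sum i) = sumAct i
act-sound rep = repAct
act-sound (loc t) = locIn (act-sound t)
act-sound (parL t) = parL (act-sound t)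
act-sound (parR t) = parR (act-sound t)

-- The alphabet of a process and the terms over an alphabet

mutual
  atoms : Proc → List Atom
  atoms hole = []
  atoms star = []
  atoms (loc a P) = inj₁ a ∷ atoms P
  atoms (P ∥ Q) = atoms P ++ atoms Q
  atoms (sum ps) = inj₂ (sum ps) ∷ atomsL ps
  atoms (rep π P) = inj₂ (rep π P) ∷ atomsPref π ++ atoms P

  atomsL : List (Pref × Proc) → List Atom
  atomsL [] = []
  atomsL ((π , P) ∷ ps) = atomsPref π ++ atoms P ++ atomsL ps

  atomsPref : Pref → List Atom
  atomsPref (inp _) = []
  atomsPref (out _) = []
  atomsPref (upd _ U) = atoms U

module _ (As : List Atom) where

  mutual
    -- `Ed2` with all location names and leaves taken from `As`, also under prefixes and inside
    -- update patterns. A step only exposes, copies or discards such subterms, so this is an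
    -- invariant.
    data Good : Proc → Set where
      loc : ∀ {a P} → inj₁ a ∈ As → Good P → Good (loc a P)
      par : ∀ {P Q} → Good P → Good Q → Good (P ∥ Q)
      sum : ∀ {ps} → inj₂ (sum ps) ∈ As → GoodSum ps → Good (sum ps)
      rep : ∀ {π P} → inj₂ (rep π P) ∈ As → GoodPref π → Good P → Good (rep π P)

    data GoodSum : List (Pref × Proc) → Set where
      []  : GoodSum []
      _∷_ : ∀ {π P ps} → GoodPref π × Good P → GoodSum ps → GoodSum ((π , P) ∷ ps)

    data GoodPref : Pref → Set where
      inp : ∀ {a} → GoodPref (inp a)
      out : ∀ {a} → GoodPref (out a)
      upd : ∀ {a U} → GoodPat U → GoodPref (upd a U)

    data GoodPat : Proc → Set where
      proc : ∀ {P} → Good P → GoodPat P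
      hole : GoodPat hole
      loc  : ∀ {a U} → inj₁ a ∈ As → GoodPat U → GoodPat (loc a U)
      par  : ∀ {U V} → GoodPat U → GoodPat V → GoodPat (U ∥ V)

module _ {As : List Atom} where

  ∷-⊆ : ∀ {x : Atom} {xs} → x ∷ xs ⊆ As → x ∈ As × xs ⊆ As
  ∷-⊆ i = i (here refl) , λ j → i (there j)

  ++-⊆ : ∀ (xs : List Atom) {ys} → xs ++ ys ⊆ As → xs ⊆ As × ys ⊆ As
  ++-⊆ xs i = (λ j → i (∈-++⁺ˡ j)) , (λ j → i (∈-++⁺ʳ xs j))

  mutual
    good : ∀ {P} → Ed2 P → atoms P ⊆ As → Good As P
    good (loc p) i = let (a , j) = ∷-⊆ i in loc a (good p j)
    good (par {P} p q) i = let (j , k) = ++-⊆ (atoms P) i in par (good p j) (good q k)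
    good (sum ps) i = let (a , j) = ∷-⊆ i in sum a (goodSum ps j)
    good (rep {π} π∈ p) i =
      let (a , j) = ∷-⊆ i
          (k , l) = ++-⊆ (atomsPref π) j
      in rep a (goodPref π∈ k) (good p l)

    goodSum : ∀ {ps} → Ed2Sum ps → atomsL ps ⊆ As → GoodSum As ps
    goodSum [] _ = []
    goodSum (_∷_ {π} {P} (π∈ , p) ps) i =
      let (j , k) = ++-⊆ (atomsPref π) i
          (l , m) = ++-⊆ (atoms P) k
      in (goodPref π∈ j , good p l) ∷ goodSum ps m

    goodPref : ∀ {π} → Ed2Pref π → atomsPref π ⊆ As → GoodPref As π
    goodPref inp _ = inp
    goodPref out _ = out
    goodPref (upd u) i = upd (goodPat u i)

    goodPat : ∀ {U} → Ed2Pat U → atoms U ⊆ As → GoodPat As U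
    goodPat (proc p) i = proc (good p i)
    goodPat hole _ = hole
    goodPat (loc u) i = let (a , j) = ∷-⊆ i in loc a (goodPat u j)
    goodPat (par {U} u v) i = let (j , k) = ++-⊆ (atoms U) i in par (goodPat u j) (goodPat v k)

  mutual
    -- Good terms contain no placeholder to fill, so filling a residual leaves the idle parallel
    -- components unchanged.
    fillStar-inert : ∀ {P} → Good As P → ∀ R → fillStar P R ≡ P
    fillStar-inert (loc _ p) R = cong (loc _) (fillStar-inert p R)
    fillStar-inert (par p q) R = cong₂ _∥_ (fillStar-inert p R) (fillStar-inert q R)
    fillStar-inert (sum _ ps) R = cong sum (fillStarL-inert ps R)
    fillStar-inert (rep _ _ p) R = cong (rep _) (fillStar-inert p R)

    fillStarL-inert : ∀ {ps} → GoodSum As ps → ∀ R → fillStarL ps R ≡ ps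
    fillStarL-inert [] R = refl
    fillStarL-inert ((_ , p) ∷ ps) R =
      cong₂ _∷_ (cong (_ ,_) (fillStar-inert p R)) (fillStarL-inert ps R)

  mutual
    fillHole-inert : ∀ {P} → Good As P → ∀ R → fillHole P R ≡ P
    fillHole-inert (loc _ p) R = cong (loc _) (fillHole-inert p R)
    fillHole-inert (par p q) R = cong₂ _∥_ (fillHole-inert p R) (fillHole-inert q R)
    fillHole-inert (sum _ ps) R = cong sum (fillHoleL-inert ps R)
    fillHole-inert (rep _ _ p) R = cong (rep _) (fillHole-inert p R)

    fillHoleL-inert : ∀ {ps} → GoodSum As ps → ∀ R → fillHoleL ps R ≡ ps
    fillHoleL-inert [] R = refl
    fillHoleL-inert ((_ , p) ∷ ps) R =
      cong₂ _∷_ (cong (_ ,_) (fillHole-inert p R)) (fillHoleL-inert ps R)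

  spec : ∀ {P α P′} → Good As P → P ─[ α ]→ P′ → Spec P α P′
  spec (loc _ _) locOut R = here
  spec _ (sumAct {π = inp _} i) = sum i
  spec _ (sumAct {π = out _} i) = sum i
  spec _ (sumAct {π = upd _ _} i) = sum i
  spec _ (repAct {π = inp _}) = rep
  spec _ (repAct {π = out _}) = rep
  spec _ (repAct {π = upd _ _}) = rep
  spec (loc _ p) (locIn {α = lin _} t) = loc (spec p t)
  spec (loc _ p) (locIn {α = lout _} t) = loc (spec p t)
  spec (loc _ p) (locIn {α = lloc _ _} t) = λ R → loc (spec p t R)
  spec (loc _ p) (locIn {α = lupd _ _} t) = loc (spec p t)
  spec (loc _ p) (locIn {α = τ} t) = loc (spec p t)
  spec (par p _) (parL {α = lin _} t) = parL (spec p t)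
  spec (par p _) (parL {α = lout _} t) = parL (spec p t)
  spec (par p q) (parL {α = lloc _ _} t) R rewrite fillStar-inert q R = parL (spec p t R)
  spec (par p _) (parL {α = lupd _ _} t) = parL (spec p t)
  spec (par p _) (parL {α = τ} t) = parL (spec p t)
  spec (par _ q) (parR {α = lin _} t) = parR (spec q t)
  spec (par _ q) (parR {α = lout _} t) = parR (spec q t)
  spec (par p q) (parR {α = lloc _ _} t) R rewrite fillStar-inert p R = parR (spec q t R)
  spec (par _ q) (parR {α = lupd _ _} t) = parR (spec q t)
  spec (par _ q) (parR {α = τ} t) = parR (spec q t)
  spec (par p q) (syncL t u) = commL (sync (spec p t) (spec q u))
  spec (par p q) (syncR t u) = commR (sync (spec q t) (spec p u))
  spec (par p q) (updL t u) = commL (update (spec p t _) (spec q u))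
  spec (par p q) (updR t u) = commR (update (spec q t _) (spec p u))

  replace-sound : ∀ {a Q R P P′} → Good As P → Replace a Q R P P′ →
    ∃ λ P″ → P ─[ lloc a Q ]→ P″ × fillStar P″ R ≡ P′
  replace-sound _ here = _ , locOut , refl
  replace-sound (loc _ p) (loc t) =
    let (_ , u , eq) = replace-sound p t in _ , locIn u , cong (loc _) eq
  replace-sound (par p q) (parL t) =
    let (_ , u , eq) = replace-sound p t in _ , parL u , cong₂ _∥_ eq (fillStar-inert q _)
  replace-sound (par p q) (parR t) =
    let (_ , u , eq) = replace-sound q t in _ , parR u , cong₂ _∥_ (fillStar-inert p _) eq

  red-sound : ∀ {P P′} → Good As P → Red P P′ → P ⟶ P′
  red-sound (loc _ p) (loc t) = locIn (red-sound p t)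
  red-sound (par p _) (parL t) = parL (red-sound p t)
  red-sound (par _ q) (parR t) = parR (red-sound q t)
  red-sound _ (commL (sync t u)) = syncL (act-sound t) (act-sound u)
  red-sound _ (commR (sync t u)) = syncR (act-sound t) (act-sound u)
  red-sound (par p _) (commL (update t u)) with replace-sound p t
  ... | _ , t′ , refl = updL t′ (act-sound u)
  red-sound (par _ p) (commR (update t u)) with replace-sound p t
  ... | _ , t′ , refl = updR t′ (act-sound u)

-- Embedding of processes

data Leaf : Proc → Set where
  sum : ∀ {ps} → Leaf (sum ps)
  rep : ∀ {π P} → Leaf (rep π P)

infix 4 _⊑_ _⊑?_

-- Homeomorphic embedding of ordered trees whose inner nodes are locations and parallel
-- compositions. Leaves are comparable only when equal.
data _⊑_ : Proc → Proc → Set where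
  leaf  : ∀ {P} → Leaf P → P ⊑ P
  loc   : ∀ {a P Q} → P ⊑ Q → loc a P ⊑ loc a Q
  par   : ∀ {P P′ Q Q′} → P ⊑ Q → P′ ⊑ Q′ → P ∥ P′ ⊑ Q ∥ Q′
  below : ∀ {a P Q} → P ⊑ Q → P ⊑ loc a Q
  left  : ∀ {P Q Q′} → P ⊑ Q → P ⊑ Q ∥ Q′
  right : ∀ {P Q Q′} → P ⊑ Q → P ⊑ Q′ ∥ Q

⊑-trans : ∀ {P Q R} → P ⊑ Q → Q ⊑ R → P ⊑ R
⊑-trans d (leaf _) = d
⊑-trans (loc d) (loc e) = loc (⊑-trans d e)
⊑-trans (below d) (loc e) = below (⊑-trans d e)
⊑-trans (par d d′) (par e e′) = par (⊑-trans d e) (⊑-trans d′ e′)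
⊑-trans (left d) (par e _) = left (⊑-trans d e)
⊑-trans (right d) (par _ e) = right (⊑-trans d e)
⊑-trans d (below e) = below (⊑-trans d e)
⊑-trans d (left e) = left (⊑-trans d e)
⊑-trans d (right e) = right (⊑-trans d e)

_⊑?_ : Decidable _⊑_
P ⊑? hole = no λ { (leaf ()) }
P ⊑? star = no λ { (leaf ()) }
P ⊑? sum ps = map′ (λ { refl → leaf sum }) (λ { (leaf _) → refl }) (P ≟ sum ps)
P ⊑? rep π Q = map′ (λ { refl → leaf rep }) (λ { (leaf _) → refl }) (P ≟ rep π Q)
P ⊑? loc b Q with P ⊑? Q
... | yes d = yes (below d)
... | no ¬below with P
...   | loc a P′ = map′ (λ { (refl , d) → loc d })
                       (λ { (loc d) → refl , d ; (below d) → ⊥-elim (¬below d) })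
                       (a ℕ.≟ b ×-dec P′ ⊑? Q)
...   | hole = no λ { (below d) → ¬below d }
...   | star = no λ { (below d) → ¬below d }
...   | _ ∥ _ = no λ { (below d) → ¬below d }
...   | sum _ = no λ { (below d) → ¬below d }
...   | rep _ _ = no λ { (below d) → ¬below d }
P ⊑? (Q ∥ Q′) with P ⊑? Q ⊎-dec P ⊑? Q′
... | yes (inj₁ d) = yes (left d)
... | yes (inj₂ d) = yes (right d)
... | no ¬side with P
...   | P₁ ∥ P₂ = map′ (λ { (d , d′) → par d d′ })
                      (λ { (par d d′) → d , d′
                         ; (left d) → ⊥-elim (¬side (inj₁ d))
                         ; (right d) → ⊥-elim (¬side (inj₂ d)) })
                      (P₁ ⊑? Q ×-dec P₂ ⊑? Q′)
...   | hole = no λ { (left d) → ¬side (inj₁ d) ; (right d) → ¬side (inj₂ d) }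
...   | star = no λ { (left d) → ¬side (inj₁ d) ; (right d) → ¬side (inj₂ d) }
...   | loc _ _ = no λ { (left d) → ¬side (inj₁ d) ; (right d) → ¬side (inj₂ d) }
...   | sum _ = no λ { (left d) → ¬side (inj₁ d) ; (right d) → ¬side (inj₂ d) }
...   | rep _ _ = no λ { (left d) → ¬side (inj₁ d) ; (right d) → ¬side (inj₂ d) }

-- Additive on ∥, so that join is subadditive and terms of bounded weight are finitely many.
weight : Proc → ℕ
weight (loc _ P) = suc (weight P)
weight (P ∥ Q) = weight P + weight Q
weight _ = 1

weight>0 : ∀ P → 1 ≤ weight P
weight>0 hole = s≤s z≤n
weight>0 star = s≤s z≤n
weight>0 (loc _ _) = s≤s z≤n
weight>0 (P ∥ Q) = ≤-trans (weight>0 P) (m≤m+n _ _)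
weight>0 (sum _) = s≤s z≤n
weight>0 (rep _ _) = s≤s z≤n

weight-leaf : ∀ {P} → Leaf P → weight P ≤ 1
weight-leaf sum = ≤-refl
weight-leaf rep = ≤-refl

module _ {As : List Atom} where

  ⊑-refl : ∀ {P} → Good As P → P ⊑ P
  ⊑-refl (loc _ p) = loc (⊑-refl p)
  ⊑-refl (par p q) = par (⊑-refl p) (⊑-refl q)
  ⊑-refl (sum _ _) = leaf sum
  ⊑-refl (rep _ _ _) = leaf rep

  good-⊑ : ∀ {P Q} → P ⊑ Q → Good As Q → Good As P
  good-⊑ (leaf _) q = q
  good-⊑ (loc d) (loc a q) = loc a (good-⊑ d q)
  good-⊑ (par d d′) (par q q′) = par (good-⊑ d q) (good-⊑ d′ q′)
  good-⊑ (below d) (loc _ q) = good-⊑ d q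
  good-⊑ (left d) (par q _) = good-⊑ d q
  good-⊑ (right d) (par _ q) = good-⊑ d q

  -- The default witness of weight one, for places where some process must stand but nothing is
  -- required of it.
  good-leaf : ∀ {P} → Good As P → ∃ λ l → Leaf l × l ⊑ P
  good-leaf (loc _ p) = let (l , L , d) = good-leaf p in l , L , below d
  good-leaf (par p _) = let (l , L , d) = good-leaf p in l , L , left d
  good-leaf (sum _ _) = _ , sum , leaf sum
  good-leaf (rep _ _ _) = _ , rep , leaf rep

  good-∈ : ∀ {π P ps} → GoodSum As ps → (π , P) ∈ ps → GoodPref As π × Good As P
  good-∈ (p ∷ _) (here refl) = p
  good-∈ (_ ∷ ps) (there i) = good-∈ ps i

  good-act : ∀ {π P P′} → Act P π P′ → Good As P → GoodPref As π × Good As P′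
  good-act (sum i) (sum _ ps) = good-∈ ps i
  good-act rep g@(rep _ π p) = π , par p g
  good-act (loc t) (loc a p) = let (π , p′) = good-act t p in π , loc a p′
  good-act (parL t) (par p q) = let (π , p′) = good-act t p in π , par p′ q
  good-act (parR t) (par p q) = let (π , q′) = good-act t q in π , par p q′

  good-target : ∀ {a Q R P P′} → Replace a Q R P P′ → Good As P → Good As Q
  good-target here (loc _ q) = q
  good-target (loc t) (loc _ p) = good-target t p
  good-target (parL t) (par p _) = good-target t p
  good-target (parR t) (par _ q) = good-target t q

  good-replace : ∀ {a Q R P P′} → Replace a Q R P P′ → Good As P → Good As R → Good As P′
  good-replace here _ r = r
  good-replace (loc t) (loc a p) r = loc a (good-replace t p r)
  good-replace (parL t) (par p q) r = par (good-replace t p r) q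
  good-replace (parR t) (par p q) r = par p (good-replace t q r)

  good-fill : ∀ {U Q} → GoodPat As U → Good As Q → Good As (fillHole U Q)
  good-fill {Q = Q} (proc p) _ = subst (Good As) (sym (fillHole-inert p Q)) p
  good-fill hole q = q
  good-fill (loc a u) q = loc a (good-fill u q)
  good-fill (par u v) q = par (good-fill u q) (good-fill v q)

  good-interact : ∀ {P P′ Q Q′} → Interact P P′ Q Q′ → Good As P → Good As Q →
                  Good As P′ × Good As Q′
  good-interact (sync t u) p q = proj₂ (good-act t p) , proj₂ (good-act u q)
  good-interact (update t u) p q with good-act u q
  ... | upd U , q′ = good-replace t p (good-fill U (good-target t p)) , q′

  good-red : ∀ {P P′} → Red P P′ → Good As P → Good As P′
  good-red (loc t) (loc a p) = loc a (good-red t p)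
  good-red (parL t) (par p q) = par (good-red t p) q
  good-red (parR t) (par p q) = par p (good-red t q)
  good-red (commL t) (par p q) = let (p′ , q′) = good-interact t p q in par p′ q′
  good-red (commR t) (par q p) = let (p′ , q′) = good-interact t p q in par q′ p′

  act-mono : ∀ {π P P′ Q} → Good As Q → P ⊑ Q → Act P π P′ → ∃ λ Q′ → Act Q π Q′ × P′ ⊑ Q′
  act-mono q (leaf _) t = _ , t , ⊑-refl (proj₂ (good-act t q))
  act-mono (loc _ q) (loc d) (loc t) = let (_ , u , e) = act-mono q d t in _ , loc u , loc e
  act-mono (par q _) (par d d′) (parL t) = let (_ , u , e) = act-mono q d t in _ , parL u , par e d′
  act-mono (par _ q) (par d d′) (parR t) = let (_ , u , e) = act-mono q d′ t in _ , parR u , par d e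
  act-mono (loc _ q) (below d) t = let (_ , u , e) = act-mono q d t in _ , loc u , below e
  act-mono (par q _) (left d) t = let (_ , u , e) = act-mono q d t in _ , parL u , left e
  act-mono (par _ q) (right d) t = let (_ , u , e) = act-mono q d t in _ , parR u , right e

  -- This rests on holes never lying under a prefix: there a filling would change a leaf, and
  -- distinct leaves are incomparable.
  fill-mono : ∀ {U P Q} → GoodPat As U → P ⊑ Q → fillHole U P ⊑ fillHole U Q
  fill-mono {P = P} {Q} (proc u) _ rewrite fillHole-inert u P | fillHole-inert u Q = ⊑-refl u
  fill-mono hole d = d
  fill-mono (loc _ u) d = loc (fill-mono u d)
  fill-mono (par u v) d = par (fill-mono u d) (fill-mono v d)

  -- The matching location of the larger process may hold a larger content `S′`, so only its name is
  -- preserved; `fill-mono` then compares the two updated contents.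
  replace-mono : ∀ {a U S P P′ Q} → GoodPat As U → P ⊑ Q → Replace a S (fillHole U S) P P′ →
    ∃ λ S′ → ∃ λ Q′ → Replace a S′ (fillHole U S′) Q Q′ × P′ ⊑ Q′
  replace-mono u (leaf ()) here
  replace-mono u (leaf ()) (loc _)
  replace-mono u (leaf ()) (parL _)
  replace-mono u (leaf ()) (parR _)
  replace-mono u (loc d) here = _ , _ , here , fill-mono u d
  replace-mono u (loc d) (loc t) =
    let (_ , _ , t′ , e) = replace-mono u d t in _ , _ , loc t′ , loc e
  replace-mono u (par d d′) (parL t) =
    let (_ , _ , t′ , e) = replace-mono u d t in _ , _ , parL t′ , par e d′
  replace-mono u (par d d′) (parR t) =
    let (_ , _ , t′ , e) = replace-mono u d′ t in _ , _ , parR t′ , par d e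
  replace-mono u (below d) t = let (_ , _ , t′ , e) = replace-mono u d t in _ , _ , loc t′ , below e
  replace-mono u (left d) t = let (_ , _ , t′ , e) = replace-mono u d t in _ , _ , parL t′ , left e
  replace-mono u (right d) t = let (_ , _ , t′ , e) = replace-mono u d t in _ , _ , parR t′ , right e

  interact-mono : ∀ {P P′ Q Q′ R S} → Good As R → Good As S → P ⊑ R → Q ⊑ S → Interact P P′ Q Q′ →
    ∃ λ R′ → ∃ λ S′ → Interact R R′ S S′ × P′ ⊑ R′ × Q′ ⊑ S′
  interact-mono r s d e (sync t u) =
    let (_ , t′ , d′) = act-mono r d t
        (_ , u′ , e′) = act-mono s e u
    in _ , _ , sync t′ u′ , d′ , e′
  interact-mono r s d e (update t u) with good-act u (good-⊑ e s)
  ... | upd U , _ =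
    let (_ , _ , t′ , d′) = replace-mono U d t
        (_ , u′ , e′) = act-mono s e u
    in _ , _ , update t′ u′ , d′ , e′

  red-mono : ∀ {P P′ Q} → Good As Q → P ⊑ Q → Red P P′ → ∃ λ Q′ → Red Q Q′ × P′ ⊑ Q′
  red-mono q (leaf ()) (loc _)
  red-mono q (leaf ()) (parL _)
  red-mono q (leaf ()) (parR _)
  red-mono q (leaf ()) (commL _)
  red-mono q (leaf ()) (commR _)
  red-mono (loc _ q) (loc d) (loc t) = let (_ , u , e) = red-mono q d t in _ , loc u , loc e
  red-mono (par q _) (par d d′) (parL t) = let (_ , u , e) = red-mono q d t in _ , parL u , par e d′
  red-mono (par _ q) (par d d′) (parR t) = let (_ , u , e) = red-mono q d′ t in _ , parR u , par d e
  red-mono (par q q′) (par d d′) (commL t) =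
    let (_ , _ , u , e , e′) = interact-mono q q′ d d′ t in _ , commL u , par e e′
  red-mono (par q′ q) (par d′ d) (commR t) =
    let (_ , _ , u , e , e′) = interact-mono q q′ d d′ t in _ , commR u , par e′ e
  red-mono (loc _ q) (below d) t = let (_ , u , e) = red-mono q d t in _ , loc u , below e
  red-mono (par q _) (left d) t = let (_ , u , e) = red-mono q d t in _ , parL u , left e
  red-mono (par _ q) (right d) t = let (_ , u , e) = red-mono q d t in _ , parR u , right e

-- Subadditive joins and small fillings

module _ {As : List Atom} where

  private
    reorder₁ : ∀ {x} a b c → x ≤ a + b → x + c ≤ (a + c) + b
    reorder₁ a b c h = ≤-trans (+-monoˡ-≤ c h) (≤-reflexive (lemma a b c))
      where lemma : ∀ a b c → (a + b) + c ≡ (a + c) + b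
            lemma = solve-∀

    reorder₂ : ∀ {x} a b c → x ≤ a + b → c + x ≤ (c + a) + b
    reorder₂ a b c h = ≤-trans (+-monoʳ-≤ c h) (≤-reflexive (sym (+-assoc c a b)))

    interchange : ∀ {x y} a b c d → x ≤ a + c → y ≤ b + d → x + y ≤ (a + b) + (c + d)
    interchange a b c d h k = ≤-trans (+-mono-≤ h k) (≤-reflexive (lemma a b c d))
      where lemma : ∀ a b c d → (a + c) + (b + d) ≡ (a + b) + (c + d)
            lemma = solve-∀

    swap : ∀ {x} a b → x ≤ a + b → x ≤ b + a
    swap a b h = ≤-trans h (≤-reflexive (+-comm a b))

    Join : Proc → Proc → Proc → Set
    Join S T P = ∃ λ U → U ⊑ P × S ⊑ U × T ⊑ U × weight U ≤ weight S + weight T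

  -- Both embeddings are followed down `P`. A node used by either is kept once, and where they part
  -- to different sides of a `∥` the two processes are put in parallel, which costs no weight.
  join : ∀ {S T P} → Good As P → S ⊑ P → T ⊑ P → Join S T P
  join _ (leaf l) (leaf _) = _ , leaf l , leaf l , leaf l , m≤m+n _ _
  join (loc _ p) (loc d) (loc e) =
    let (_ , f , d′ , e′ , h) = join p d e
    in _ , loc f , loc d′ , loc e′ , s≤s (≤-trans h (+-monoʳ-≤ _ (n≤1+n _)))
  join (loc _ p) (loc d) (below e) =
    let (_ , f , d′ , e′ , h) = join p d e in _ , loc f , loc d′ , below e′ , s≤s h
  join (loc _ p) (below d) (loc e) =
    let (_ , f , d′ , e′ , h) = join p d e
    in _ , loc f , below d′ , loc e′ , ≤-trans (s≤s h) (≤-reflexive (sym (+-suc _ _)))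
  join (loc _ p) (below d) (below e) =
    let (_ , f , d′ , e′ , h) = join p d e in _ , below f , d′ , e′ , h
  join (par p q) (left d) (left e) =
    let (_ , f , d′ , e′ , h) = join p d e in _ , left f , d′ , e′ , h
  join (par p q) (right d) (right e) =
    let (_ , f , d′ , e′ , h) = join q d e in _ , right f , d′ , e′ , h
  join (par p q) (left d) (right e) =
    _ , par d e , left (⊑-refl (good-⊑ d p)) , right (⊑-refl (good-⊑ e q)) , ≤-refl
  join {S} {T} (par p q) (right d) (left e) =
    _ , par e d , right (⊑-refl (good-⊑ d q)) , left (⊑-refl (good-⊑ e p)) ,
    swap (weight T) (weight S) ≤-refl
  join {S₁ ∥ S₂} {T} (par p q) (par d₁ d₂) (left e) =
    let (_ , f , d′ , e′ , h) = join p d₁ e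
    in _ , par f d₂ , par d′ (⊑-refl (good-⊑ d₂ q)) , left e′ ,
       reorder₁ (weight S₁) (weight T) (weight S₂) h
  join {S₁ ∥ S₂} {T} (par p q) (par d₁ d₂) (right e) =
    let (_ , f , d′ , e′ , h) = join q d₂ e
    in _ , par d₁ f , par (⊑-refl (good-⊑ d₁ p)) d′ , right e′ ,
       reorder₂ (weight S₂) (weight T) (weight S₁) h
  join {S} {T₁ ∥ T₂} (par p q) (left d) (par e₁ e₂) =
    let (_ , f , d′ , e′ , h) = join p d e₁
    in _ , par f e₂ , left d′ , par e′ (⊑-refl (good-⊑ e₂ q)) ,
       swap (weight T₁ + weight T₂) (weight S)
         (reorder₁ (weight T₁) (weight S) (weight T₂) (swap (weight S) (weight T₁) h))
  join {S} {T₁ ∥ T₂} (par p q) (right d) (par e₁ e₂) =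
    let (_ , f , d′ , e′ , h) = join q d e₂
    in _ , par e₁ f , right d′ , par (⊑-refl (good-⊑ e₁ p)) e′ ,
       swap (weight T₁ + weight T₂) (weight S)
         (reorder₂ (weight T₂) (weight S) (weight T₁) (swap (weight S) (weight T₂) h))
  join {S₁ ∥ S₂} {T₁ ∥ T₂} (par p q) (par d₁ d₂) (par e₁ e₂) =
    let (_ , f , d′ , e′ , h) = join p d₁ e₁
        (_ , g , d″ , e″ , k) = join q d₂ e₂
    in _ , par f g , par d′ d″ , par e′ e″ ,
       interchange (weight S₁) (weight S₂) (weight T₁) (weight T₂) h k

  -- Different holes may place different requirements on the same `Q`; `join` meets them together
  -- within the weight of `S`.
  small-fill : ∀ {U Q S} → GoodPat As U → Good As Q → S ⊑ fillHole U Q →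
    ∃ λ q → q ⊑ Q × S ⊑ fillHole U q × weight q ≤ weight S
  small-fill {U} {Q} {S} (proc u) q d =
    -- A hole-free pattern demands nothing of its argument, so a leaf is enough.
    let (l , L , e) = good-leaf q
    in l , e , subst (S ⊑_) (trans (fillHole-inert u Q) (sym (fillHole-inert u l))) d ,
       ≤-trans (weight-leaf L) (weight>0 S)
  small-fill hole q d = _ , d , ⊑-refl (good-⊑ d q) , ≤-refl
  small-fill (loc _ u) q (loc d) =
    let (_ , e , d′ , h) = small-fill u q d in _ , e , loc d′ , m≤n⇒m≤1+n h
  small-fill (loc _ u) q (below d) =
    let (_ , e , d′ , h) = small-fill u q d in _ , e , below d′ , h
  small-fill (par u v) q (left d) =
    let (_ , e , d′ , h) = small-fill u q d in _ , e , left d′ , h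
  small-fill (par u v) q (right d) =
    let (_ , e , d′ , h) = small-fill v q d in _ , e , right d′ , h
  small-fill (par u v) q (par d₁ d₂) =
    let (_ , e₁ , d₁′ , h₁) = small-fill u q d₁
        (_ , e₂ , d₂′ , h₂) = small-fill v q d₂
        (_ , e , f₁ , f₂ , h) = join q e₁ e₂
    in _ , e , par (⊑-trans d₁′ (fill-mono u f₁)) (⊑-trans d₂′ (fill-mono v f₂)) ,
       ≤-trans h (+-mono-≤ h₁ h₂)

-- The empty requirement arises when the other parallel component covers S without moving.
_⊑ᵐ_ : Maybe Proc → Proc → Set
nothing ⊑ᵐ P = ⊤
just S  ⊑ᵐ P = S ⊑ P

weightᵐ : Maybe Proc → ℕ
weightᵐ nothing = 0
weightᵐ (just S) = weight S

-- Predecessors of bounded weight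

module _ {As : List Atom} where

  -- The constant `c` is the price of the redex alone. All other weight is charged to the
  -- requirement `m`, so the bound does not depend on `P`.
  SmallBefore : (Proc → Proc → Set) → ℕ → Maybe Proc → Proc → Set
  SmallBefore Step c m P = ∃ λ u → u ⊑ P × (∃ λ u′ → Step u u′ × m ⊑ᵐ u′) × weight u ≤ c + weightᵐ m

  record Congruent (Step : Proc → Proc → Set) : Set where
    field
      in-loc  : ∀ {a P P′} → Step P P′ → Step (loc a P) (loc a P′)
      in-parL : ∀ {P P′ Q} → Step P P′ → Step (P ∥ Q) (P′ ∥ Q)
      in-parR : ∀ {P Q Q′} → Step Q Q′ → Step (P ∥ Q) (P ∥ Q′)

  module _ {Step : Proc → Proc → Set} (step : Congruent Step) {c : ℕ} where
    private module C = Congruent step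

    small-loc : ∀ m {a P P′} → (∀ m → m ⊑ᵐ P′ → SmallBefore Step c m P) →
                m ⊑ᵐ loc a P′ → SmallBefore Step c m (loc a P)
    small-loc nothing rec _ =
      let (_ , d , (_ , t , _) , h) = rec nothing tt in _ , below d , (_ , t , tt) , h
    small-loc (just _) rec (leaf ())
    small-loc (just (loc a S)) rec (loc e) =
      let (_ , d , (_ , t , f) , h) = rec (just _) e
      in _ , loc d , (_ , C.in-loc t , loc f) , ≤-trans (s≤s h) (≤-reflexive (sym (+-suc c _)))
    small-loc (just _) rec (below e) =
      let (_ , d , (_ , t , f) , h) = rec (just _) e in _ , below d , (_ , t , f) , h

    small-parL : ∀ m {P P′ Q} → (∀ m → m ⊑ᵐ P′ → SmallBefore Step c m P) → Good As Q →
                 m ⊑ᵐ (P′ ∥ Q) → SmallBefore Step c m (P ∥ Q)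
    small-parL nothing rec q _ =
      let (_ , d , (_ , t , _) , h) = rec nothing tt in _ , left d , (_ , t , tt) , h
    small-parL (just _) rec q (leaf ())
    small-parL (just S) rec q (left e) =
      let (_ , d , (_ , t , f) , h) = rec (just S) e in _ , left d , (_ , t , f) , h
    small-parL (just S) rec q (right e) =
      -- The idle component covers `S` alone, but an active part of weight at most `c` must be kept
      -- for the step to happen.
      let (_ , d , (_ , t , _) , h) = rec nothing tt
      in _ , par d e , (_ , C.in-parL t , right (⊑-refl (good-⊑ e q))) ,
         +-monoˡ-≤ (weight S) (subst (_ ≤_) (+-identityʳ c) h)
    small-parL (just (S₁ ∥ S₂)) rec q (par e₁ e₂) =
      let (_ , d , (_ , t , f) , h) = rec (just S₁) e₁
      in _ , par d e₂ , (_ , C.in-parL t , par f (⊑-refl (good-⊑ e₂ q))) ,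
         ≤-trans (+-monoˡ-≤ (weight S₂) h) (≤-reflexive (+-assoc c (weight S₁) (weight S₂)))

    small-parR : ∀ m {P Q Q′} → (∀ m → m ⊑ᵐ Q′ → SmallBefore Step c m Q) → Good As P →
                 m ⊑ᵐ (P ∥ Q′) → SmallBefore Step c m (P ∥ Q)
    small-parR nothing rec p _ =
      let (_ , d , (_ , t , _) , h) = rec nothing tt in _ , right d , (_ , t , tt) , h
    small-parR (just _) rec p (leaf ())
    small-parR (just S) rec p (right e) =
      let (_ , d , (_ , t , f) , h) = rec (just S) e in _ , right d , (_ , t , f) , h
    small-parR (just S) rec p (left e) =
      let (u , d , (_ , t , _) , h) = rec nothing tt
      in _ , par e d , (_ , C.in-parR t , left (⊑-refl (good-⊑ e p))) ,
         ≤-trans (≤-reflexive (+-comm (weight S) (weight u)))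
                 (+-monoˡ-≤ (weight S) (subst (_ ≤_) (+-identityʳ c) h))
    small-parR (just (S₁ ∥ S₂)) rec p (par e₁ e₂) =
      let (_ , d , (_ , t , f) , h) = rec (just S₂) e₂
      in _ , par e₁ d , (_ , C.in-parR t , par (⊑-refl (good-⊑ e₁ p)) f) ,
         ≤-trans (+-monoʳ-≤ (weight S₁) h) (≤-reflexive (lemma (weight S₁) c (weight S₂)))
      where lemma : ∀ a b c → a + (b + c) ≡ b + (a + c)
            lemma = solve-∀

  act-congruent : ∀ {π} → Congruent λ P P′ → Act P π P′
  act-congruent = record { in-loc = loc ; in-parL = parL ; in-parR = parR }

  -- The acting leaf is kept whole and yields its full continuation, so one unit of weight pays for
  -- it whatever `m` asks.
  small-act : ∀ {π P P′} → Act P π P′ → Good As P →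
    ∀ m → m ⊑ᵐ P′ → SmallBefore (λ P P′ → Act P π P′) 1 m P
  small-act (sum i) _ m d = _ , leaf sum , (_ , sum i , d) , s≤s z≤n
  small-act rep _ m d = _ , leaf rep , (_ , rep , d) , s≤s z≤n
  small-act (loc t) (loc _ p) m = small-loc act-congruent m (small-act t p)
  small-act (parL t) (par p q) m = small-parL act-congruent m (small-act t p) q
  small-act (parR t) (par p q) m = small-parR act-congruent m (small-act t q) p

  Update : Name → Proc → Proc → Proc → Set
  Update a U P P′ = ∃ λ Q → Replace a Q (fillHole U Q) P P′

  update-congruent : ∀ {a U} → Congruent (Update a U)
  update-congruent = record
    { in-loc  = λ (_ , t) → _ , loc t
    ; in-parL = λ (_ , t) → _ , parL t
    ; in-parR = λ (_ , t) → _ , parR t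
    }

  -- The 2 pays for the location and for a leaf inside it when nothing is required. Otherwise
  -- `small-fill` provides the content.
  small-update : ∀ {a U Q P P′} → GoodPat As U → Replace a Q (fillHole U Q) P P′ → Good As P →
    ∀ m → m ⊑ᵐ P′ → SmallBefore (Update a U) 2 m P
  small-update u here (loc _ q) nothing _ =
    let (_ , L , d) = good-leaf q
    in _ , loc d , (_ , (_ , here) , tt) , s≤s (weight-leaf L)
  small-update u here (loc _ q) (just _) d =
    let (_ , e , d′ , h) = small-fill u q d
    in _ , loc e , (_ , (_ , here) , d′) , s≤s (m≤n⇒m≤1+n h)
  small-update u (loc t) (loc _ p) m = small-loc update-congruent m (small-update u t p)
  small-update u (parL t) (par p q) m = small-parL update-congruent m (small-update u t p) q
  small-update u (parR t) (par p q) m = small-parR update-congruent m (small-update u t q) p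

  -- The constant 3 adds 2 for the updated location and 1 for the update prefix; a synchronisation
  -- costs 1 on each side.
  small-interact : ∀ {P P′ Q Q′} → Interact P P′ Q Q′ → Good As P → Good As Q →
    ∀ m n → m ⊑ᵐ P′ → n ⊑ᵐ Q′ →
    ∃ λ u → ∃ λ v → u ⊑ P × v ⊑ Q ×
      (∃ λ u′ → ∃ λ v′ → Interact u u′ v v′ × m ⊑ᵐ u′ × n ⊑ᵐ v′) ×
      weight u + weight v ≤ 3 + (weightᵐ m + weightᵐ n)
  small-interact (sync t t′) p q m n d e =
    let (_ , d′ , (_ , s , f) , h) = small-act t p m d
        (_ , e′ , (_ , s′ , f′) , h′) = small-act t′ q n e
    in _ , _ , d′ , e′ , (_ , _ , sync s s′ , f , f′) ,
       m≤n⇒m≤1+n (≤-trans (+-mono-≤ h h′) (≤-reflexive (lemma (weightᵐ m) (weightᵐ n))))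
    where lemma : ∀ a b → (1 + a) + (1 + b) ≡ 2 + (a + b)
          lemma = solve-∀
  small-interact (update t t′) p q m n d e with good-act t′ q
  ... | upd U , _ =
    let (_ , d′ , (_ , (_ , s) , f) , h) = small-update U t p m d
        (_ , e′ , (_ , s′ , f′) , h′) = small-act t′ q n e
    in _ , _ , d′ , e′ , (_ , _ , update s s′ , f , f′) ,
       ≤-trans (+-mono-≤ h h′) (≤-reflexive (lemma (weightᵐ m) (weightᵐ n)))
    where lemma : ∀ a b → (2 + a) + (1 + b) ≡ 3 + (a + b)
          lemma = solve-∀

  -- Used when both components move: each receives its share of the requirement, and the last clause
  -- reassembles the shares over any new pair.
  split-∥ : ∀ m {P Q} → m ⊑ᵐ (P ∥ Q) → ∃ λ m₁ → ∃ λ m₂ →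
    m₁ ⊑ᵐ P × m₂ ⊑ᵐ Q × weightᵐ m₁ + weightᵐ m₂ ≤ weightᵐ m ×
    (∀ {P′ Q′} → m₁ ⊑ᵐ P′ → m₂ ⊑ᵐ Q′ → m ⊑ᵐ (P′ ∥ Q′))
  split-∥ nothing _ = nothing , nothing , tt , tt , z≤n , λ _ _ → tt
  split-∥ (just _) (leaf ())
  split-∥ (just S) (left d) = just S , nothing , d , tt , ≤-reflexive (+-identityʳ _) , λ d _ → left d
  split-∥ (just S) (right d) = nothing , just S , tt , d , ≤-refl , λ _ d → right d
  split-∥ (just (S₁ ∥ S₂)) (par d₁ d₂) = just S₁ , just S₂ , d₁ , d₂ , ≤-refl , par

  red-congruent : Congruent Red
  red-congruent = record { in-loc = loc ; in-parL = parL ; in-parR = parR }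

  small-red : ∀ {P P′} → Red P P′ → Good As P → ∀ m → m ⊑ᵐ P′ → SmallBefore Red 3 m P
  small-red (loc t) (loc _ p) m = small-loc red-congruent m (small-red t p)
  small-red (parL t) (par p q) m = small-parL red-congruent m (small-red t p) q
  small-red (parR t) (par p q) m = small-parR red-congruent m (small-red t q) p
  small-red (commL t) (par p q) m d =
    let (m₁ , m₂ , d₁ , d₂ , h , cover) = split-∥ m d
        (_ , _ , e₁ , e₂ , (_ , _ , s , f₁ , f₂) , k) = small-interact t p q m₁ m₂ d₁ d₂
    in _ , par e₁ e₂ , (_ , commL s , cover f₁ f₂) , ≤-trans k (+-monoʳ-≤ 3 h)
  small-red (commR t) (par q p) m d =
    let (m₂ , m₁ , d₂ , d₁ , h , cover) = split-∥ m d
        (u , v , e₁ , e₂ , (_ , _ , s , f₁ , f₂) , k) = small-interact t p q m₁ m₂ d₁ d₂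
    in _ , par e₂ e₁ , (_ , commR s , cover f₂ f₁) ,
       ≤-trans (≤-reflexive (+-comm (weight v) (weight u)))
         (≤-trans k (+-monoʳ-≤ 3 (≤-trans (≤-reflexive (+-comm (weightᵐ m₁) (weightᵐ m₂))) h)))

module _ {As : List Atom} where

  mutual
    -- Leaves of the alphabet are subterms of good processes, hence good; this lets terms freely
    -- generated from the alphabet be good as well.
    good-atom : ∀ {P l} → Good As P → inj₂ l ∈ atoms P → Good As l
    good-atom (loc _ p) (there i) = good-atom p i
    good-atom (par {P} p q) i = [ good-atom p , good-atom q ]′ (∈-++⁻ (atoms P) i)
    good-atom p@(sum _ _) (here refl) = p
    good-atom (sum _ ps) (there i) = good-atomL ps i
    good-atom p@(rep _ _ _) (here refl) = p
    good-atom (rep {π} _ π∈ p) (there i) =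
      [ good-atomPref π∈ , good-atom p ]′ (∈-++⁻ (atomsPref π) i)

    good-atomL : ∀ {ps l} → GoodSum As ps → inj₂ l ∈ atomsL ps → Good As l
    good-atomL (_∷_ {π} {P} (π∈ , p) ps) i =
      [ good-atomPref π∈ , [ good-atom p , good-atomL ps ]′ ∘ ∈-++⁻ (atoms P) ]′
        (∈-++⁻ (atomsPref π) i)

    good-atomPref : ∀ {π l} → GoodPref As π → inj₂ l ∈ atomsPref π → Good As l
    good-atomPref (upd u) i = good-atomPat u i

    good-atomPat : ∀ {U l} → GoodPat As U → inj₂ l ∈ atoms U → Good As l
    good-atomPat (proc p) i = good-atom p i
    good-atomPat (loc _ u) (there i) = good-atomPat u i
    good-atomPat (par {U} u v) i = [ good-atomPat u , good-atomPat v ]′ (∈-++⁻ (atoms U) i)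

-- Backward coverability

Trans : Proc → Set
Trans P = ∃ λ α → ∃ λ P′ → P ─[ α ]→ P′

commsL : ∀ {P Q} → Trans P → Trans Q → List (Trans (P ∥ Q))
commsL (lin a , _ , t) (lout b , _ , u) with a ℕ.≟ b
... | yes refl = (τ , _ , syncL t u) ∷ []
... | no _ = []
commsL (lloc a _ , _ , t) (lupd b _ , _ , u) with a ℕ.≟ b
... | yes refl = (τ , _ , updL t u) ∷ []
... | no _ = []
commsL _ _ = []

commsR : ∀ {P Q} → Trans P → Trans Q → List (Trans (P ∥ Q))
commsR (lout b , _ , u) (lin a , _ , t) with a ℕ.≟ b
... | yes refl = (τ , _ , syncR t u) ∷ []
... | no _ = []
commsR (lupd b _ , _ , u) (lloc a _ , _ , t) with a ℕ.≟ b
... | yes refl = (τ , _ , updR t u) ∷ []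
... | no _ = []
commsR _ _ = []

-- Finite branching. Each entry carries its derivation, so soundness is part of the type and only
-- completeness has to be proved.
transitions : ∀ P → List (Trans P)
transitions hole = []
transitions star = []
transitions (loc a P) =
  (_ , _ , locOut) ∷ map (λ (α , P′ , t) → α , loc a P′ , locIn t) (transitions P)
transitions (P ∥ Q) =
  map (λ (α , P′ , t) → α , P′ ∥ Q , parL t) (transitions P) ++
  map (λ (α , Q′ , t) → α , P ∥ Q′ , parR t) (transitions Q) ++
  concat (cartesianProductWith commsL (transitions P) (transitions Q)) ++
  concat (cartesianProductWith commsR (transitions P) (transitions Q))
transitions (sum ps) = mapWith∈ ps λ i → _ , _ , sumAct i
transitions (rep π P) = (_ , _ , repAct) ∷ []

∈-transitions : ∀ {P α P′} (t : P ─[ α ]→ P′) → (α , P′ , t) ∈ transitions P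
∈-commsL : ∀ {P α P′ Q β Q′ t} (u : P ─[ α ]→ P′) (v : Q ─[ β ]→ Q′) →
           t ∈ commsL (_ , _ , u) (_ , _ , v) → t ∈ transitions (P ∥ Q)
∈-commsR : ∀ {P α P′ Q β Q′ t} (u : P ─[ α ]→ P′) (v : Q ─[ β ]→ Q′) →
           t ∈ commsR (_ , _ , u) (_ , _ , v) → t ∈ transitions (P ∥ Q)

∈-transitions locOut = here refl
∈-transitions (sumAct i) = mapWith∈⁺ _ (_ , i , refl)
∈-transitions repAct = here refl
∈-transitions (locIn t) = there (∈-map⁺ _ (∈-transitions t))
∈-transitions (parL t) = ∈-++⁺ˡ (∈-map⁺ _ (∈-transitions t))
∈-transitions {P ∥ _} (parR t) =
  ∈-++⁺ʳ (map _ (transitions P)) (∈-++⁺ˡ (∈-map⁺ _ (∈-transitions t)))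
∈-transitions (syncL {a} t u) = ∈-commsL t u member
  where
  member : (τ , _ , syncL t u) ∈ commsL (_ , _ , t) (_ , _ , u)
  member with a ℕ.≟ a
  ... | yes refl = here refl
  ... | no a≢a = ⊥-elim (a≢a refl)
∈-transitions (syncR {a} t u) = ∈-commsR u t member
  where
  member : (τ , _ , syncR t u) ∈ commsR (_ , _ , u) (_ , _ , t)
  member with a ℕ.≟ a
  ... | yes refl = here refl
  ... | no a≢a = ⊥-elim (a≢a refl)
∈-transitions (updL {a} t u) = ∈-commsL t u member
  where
  member : (τ , _ , updL t u) ∈ commsL (_ , _ , t) (_ , _ , u)
  member with a ℕ.≟ a
  ... | yes refl = here refl
  ... | no a≢a = ⊥-elim (a≢a refl)
∈-transitions (updR {a} t u) = ∈-commsR u t member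
  where
  member : (τ , _ , updR t u) ∈ commsR (_ , _ , u) (_ , _ , t)
  member with a ℕ.≟ a
  ... | yes refl = here refl
  ... | no a≢a = ⊥-elim (a≢a refl)

∈-commsL {P} {Q = Q} u v i =
  ∈-++⁺ʳ (map _ (transitions P)) (∈-++⁺ʳ (map _ (transitions Q)) (∈-++⁺ˡ
    (∈-concat⁺′ i (∈-cartesianProductWith⁺ commsL (∈-transitions u) (∈-transitions v)))))
∈-commsR {P} {Q = Q} u v i =
  ∈-++⁺ʳ (map _ (transitions P)) (∈-++⁺ʳ (map _ (transitions Q))
    (∈-++⁺ʳ (concat (cartesianProductWith commsL (transitions P) (transitions Q)))
    (∈-concat⁺′ i (∈-cartesianProductWith⁺ commsR (∈-transitions u) (∈-transitions v)))))

τ? : ∀ α → Dec (α ≡ τ)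
τ? (lin _) = no λ ()
τ? (lout _) = no λ ()
τ? (lloc _ _) = no λ ()
τ? (lupd _ _) = no λ ()
τ? τ = yes refl

barbLabel? : ∀ e α → Dec (α ≡ barbLabel e)
barbLabel? (bin a) (lin b) = map′ (cong lin) (λ { refl → refl }) (b ℕ.≟ a)
barbLabel? (bin _) (lout _) = no λ ()
barbLabel? (bin _) (lloc _ _) = no λ ()
barbLabel? (bin _) (lupd _ _) = no λ ()
barbLabel? (bin _) τ = no λ ()
barbLabel? (bout _) (lin _) = no λ ()
barbLabel? (bout a) (lout b) = map′ (cong lout) (λ { refl → refl }) (b ℕ.≟ a)
barbLabel? (bout _) (lloc _ _) = no λ ()
barbLabel? (bout _) (lupd _ _) = no λ ()
barbLabel? (bout _) τ = no λ ()

-- Deciding chains within a bounded number of steps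

Next : (Proc → Set) → Proc → Set
Next V P = ∃ λ P′ → P ⟶ P′ × V P′

transition? : ∀ {α} {V : Proc → Set} → (∀ β → Dec (β ≡ α)) → (∀ P → Dec (V P)) →
              ∀ P → Dec (∃ λ P′ → P ─[ α ]→ P′ × V P′)
transition? α? V? P =
  map′ (λ some → case Any.satisfied some of λ { ((_ , _ , t) , refl , v) → _ , t , v })
       (λ (_ , t , v) → lose (∈-transitions t) (refl , v))
       (any? (λ (β , P′ , _) → α? β ×-dec V? P′) (transitions P))

barb? : ∀ e P → Dec (P ↓ barbLabel e)
barb? e P = map′ (λ (_ , t , _) → _ , t) (λ (_ , t) → _ , t , tt)
                 (transition? (barbLabel? e) (λ _ → yes tt) P)

chain? : ∀ e k P → Dec (Chain e k P)
chain? e zero P = yes done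
chain? e (suc zero) P = map′ last (λ { (last b) → b }) (barb? e P)
chain? e (suc (suc k)) P =
  map′ (λ (b , _ , t , c) → step b t c) (λ { (step b t c) → b , _ , t , c })
       (barb? e P ×-dec transition? τ? (chain? e (suc k)) P)

-- The stages of backward search: increasing in `n`, with union `WeakBarb`.
Within : Barb → ℕ → ℕ → Proc → Set
Within e k zero = Chain e k
Within e k (suc n) P = Within e k n P ⊎ Next (Within e k n) P

within? : ∀ e k n P → Dec (Within e k n P)
within? e k zero = chain? e k
within? e k (suc n) P = within? e k n P ⊎-dec transition? τ? (within? e k n) P

within⇒weakBarb : ∀ {e k} n {P} → Within e k n P → WeakBarb P e k
within⇒weakBarb zero c = _ , ε , c
within⇒weakBarb (suc n) (inj₁ w) = within⇒weakBarb n w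
within⇒weakBarb (suc n) (inj₂ (_ , t , w)) =
  let (_ , ts , c) = within⇒weakBarb n w in _ , t ◅ ts , c

-- Upward closure and weight bounds of the stages

module _ (As : List Atom) where

  Upward : (Proc → Set) → Set
  Upward V = ∀ {P Q} → Good As Q → P ⊑ Q → V P → V Q

  -- An effective finite basis: on good processes, an upward-closed `V` with this property is
  -- determined by its members of weight at most `d`.
  Small : (Proc → Set) → ℕ → Set
  Small V d = ∀ {P} → Good As P → V P → ∃ λ u → u ⊑ P × V u × weight u ≤ d

module _ {As : List Atom} where

  upward-next : ∀ {V} → Upward As V → Upward As (Next V)
  upward-next up q d (_ , t , v) =
    let r = spec (good-⊑ d q) t
        (_ , s , e) = red-mono q d r
    in _ , red-sound q s , up (good-red s q) e v

  -- The successor is first shrunk inside `V`; `small-red` then pulls that small target back through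
  -- the step.
  small-next : ∀ {V d} → Upward As V → Small As V d → Small As (Next V) (3 + d)
  small-next up small p (_ , t , v) =
    let r = spec p t
        p′ = good-red r p
        (_ , e , v′ , h) = small p′ v
        (_ , f , (_ , s , g) , k) = small-red r p (just _) e
        q = good-⊑ f p
    in _ , f , (_ , red-sound q s , up (good-red s q) g v′) , ≤-trans k (+-monoʳ-≤ 3 h)

  upward-barb : ∀ e → Upward As (_↓ barbLabel e)
  upward-barb (bin _) q d (_ , t) =
    let (_ , s , _) = act-mono q d (spec (good-⊑ d q) t) in _ , act-sound s
  upward-barb (bout _) q d (_ , t) =
    let (_ , s , _) = act-mono q d (spec (good-⊑ d q) t) in _ , act-sound s

  small-barb : ∀ e → Small As (_↓ barbLabel e) 1
  small-barb (bin _) p (_ , t) =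
    let (_ , d , (_ , s , _) , h) = small-act (spec p t) p nothing tt in _ , d , (_ , act-sound s) , h
  small-barb (bout _) p (_ , t) =
    let (_ , d , (_ , s , _) , h) = small-act (spec p t) p nothing tt in _ , d , (_ , act-sound s) , h

  upward-chain : ∀ {e} k → Upward As (Chain e k)
  upward-chain zero _ _ done = done
  upward-chain {e} (suc zero) q d (last b) = last (upward-barb e q d b)
  upward-chain {e} (suc (suc k)) q d (step b t c) =
    let (_ , t′ , c′) = upward-next (upward-chain (suc k)) q d (_ , t , c)
    in step (upward-barb e q d b) t′ c′

  small-chain : ∀ {e} k → ∃ (Small As (Chain e k))
  small-chain zero = 1 , λ p _ → let (_ , L , d) = good-leaf p in _ , d , done , weight-leaf L
  small-chain {e} (suc zero) = 1 , λ { p (last b) →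
    let (_ , d , b′ , h) = small-barb e p b in _ , d , last b′ , h }
  small-chain {e} (suc (suc k)) with small-chain {e} (suc k)
  -- The same process must show the barb, at cost 1, and step into the remaining chain, at cost
  -- `3 + n`; `join` combines the two witnesses.
  ... | n , small = 1 + (3 + n) , λ { p (step b t c) →
    let (_ , d₁ , b₁ , h₁) = small-barb e p b
        (_ , d₂ , c₂ , h₂) = small-next up small p (_ , t , c)
        (_ , d , e₁ , e₂ , h) = join p d₁ d₂
        u = good-⊑ d p
        (_ , t′ , c′) = upward-next up u e₂ c₂
    in _ , d , step (upward-barb e u e₁ b₁) t′ c′ , ≤-trans h (+-mono-≤ h₁ h₂) }
    where
    up : Upward As (Chain e (suc k))
    up = upward-chain (suc k)

  upward-within : ∀ {e k} n → Upward As (Within e k n)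
  upward-within zero = upward-chain _
  upward-within (suc n) q d (inj₁ w) = inj₁ (upward-within n q d w)
  upward-within (suc n) q d (inj₂ w) = inj₂ (upward-next (upward-within n) q d w)

  small-within : ∀ {e k} n → ∃ (Small As (Within e k n))
  small-within zero = small-chain _
  small-within (suc n) =
    let (d , small) = small-within n
    in 3 + d , λ
      { p (inj₁ w) → let (_ , e , w′ , h) = small p w in _ , e , inj₁ w′ , ≤-trans h (m≤n+m d 3)
      ; p (inj₂ w) →
          let (_ , e , w′ , h) = small-next (upward-within n) small p w in _ , e , inj₂ w′ , h }

-- Well-quasi-order and enumeration over a finite alphabet

data Encodes : Proc → Tree Name Proc → Set where
  leaf : ∀ {P} → Leaf P → Encodes P (leaf P)
  loc  : ∀ {a P t} → Encodes P t → Encodes (loc a P) (una a t)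
  par  : ∀ {P Q t u} → Encodes P t → Encodes Q u → Encodes (P ∥ Q) (bin t u)

encodes-reflects : ∀ {P Q t u} → Encodes P t → Encodes Q u → Emb _≡_ _≡_ t u → P ⊑ Q
encodes-reflects (leaf l) (leaf _) (leaf refl) = leaf l
encodes-reflects (loc c) (loc d) (una refl e) = loc (encodes-reflects c d e)
encodes-reflects (par c c′) (par d d′) (bin e e′) =
  par (encodes-reflects c d e) (encodes-reflects c′ d′ e′)
encodes-reflects c (loc d) (below e) = below (encodes-reflects c d e)
encodes-reflects c (par d _) (left e) = left (encodes-reflects c d e)
encodes-reflects c (par _ d) (right e) = right (encodes-reflects c d e)

module _ (As : List Atom) where

  encode : ∀ {P} → Good As P →
    ∃ λ t → Encodes P t × Over true (λ a → inj₁ a ∈ As) (λ l → inj₂ l ∈ As) t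
  encode (loc a p) = let (_ , c , o) = encode p in _ , loc c , una a o
  encode (par p q) =
    let (_ , c , o) = encode p
        (_ , c′ , o′) = encode q
    in _ , par c c′ , bin tt o o′
  encode (sum l _) = _ , leaf sum , leaf l
  encode (rep l _ _) = _ , leaf rep , leaf l

  -- On a finite alphabet equality is already a well-quasi-order of names and of leaves, so
  -- Kruskal's theorem applies to the encoding trees.
  wq-⊑ : WQ _⊑_ (Good As)
  wq-⊑ = wq-reflect Encodes encode encodes-reflects
    (wq-tree ℕ._≟_ _≟_
      (wq-reflect (λ a x → x ≡ inj₁ a) (λ i → _ , refl , i) (λ { refl refl refl → refl }) (wq-∈ As))
      (wq-reflect (λ l x → x ≡ inj₂ l) (λ i → _ , refl , i) (λ { refl refl refl → refl }) (wq-∈ As)))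

  mutual
    -- Generated by depth, so heavier terms occur too. All good terms of weight at most `n` are
    -- reached, because both sides of a `∥` have positive weight and hence weigh less than the
    -- whole.
    terms : ℕ → List Proc
    terms zero = []
    terms (suc n) = concatMap (rooted n) As ++ cartesianProductWith _∥_ (terms n) (terms n)

    rooted : ℕ → Atom → List Proc
    rooted n (inj₁ a) = map (loc a) (terms n)
    rooted n (inj₂ l) = l ∷ []

  ∈-terms : ∀ n {P} → Good As P → weight P ≤ n → P ∈ terms n
  ∈-terms zero {P} _ h = ⊥-elim (1+n≰n (≤-trans (weight>0 P) h))
  ∈-terms (suc n) (loc {a} i p) (s≤s h) =
    ∈-++⁺ˡ (∈-concatMap⁺ (rooted n) (lose i (∈-map⁺ (loc a) (∈-terms n p h))))
  ∈-terms (suc n) (sum i _) _ = ∈-++⁺ˡ (∈-concatMap⁺ (rooted n) (lose i (here refl)))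
  ∈-terms (suc n) (rep i _ _) _ = ∈-++⁺ˡ (∈-concatMap⁺ (rooted n) (lose i (here refl)))
  ∈-terms (suc n) (par {P} {Q} p q) h =
    ∈-++⁺ʳ (concatMap (rooted n) As) (∈-cartesianProductWith⁺ _∥_
      (∈-terms n p (≤-pred (≤-trans (≤-reflexive (+-comm 1 (weight P)))
                                    (≤-trans (+-monoʳ-≤ (weight P) (weight>0 Q)) h))))
      (∈-terms n q (≤-pred (≤-trans (+-monoˡ-≤ (weight Q) (weight>0 P)) h))))

  module _ (good-∈As : ∀ {l} → inj₂ l ∈ As → Good As l) where

    good-terms : ∀ n {P} → P ∈ terms n → Good As P
    good-rooted : ∀ n {x P} → x ∈ As → P ∈ rooted n x → Good As P

    good-terms (suc n) i with ∈-++⁻ (concatMap (rooted n) As) i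
    ... | inj₁ j = let (_ , k , l) = find (∈-concatMap⁻ (rooted n) j) in good-rooted n k l
    ... | inj₂ j with ∈-cartesianProductWith⁻ _∥_ (terms n) (terms n) j
    ...   | _ , _ , k , l , refl = par (good-terms n k) (good-terms n l)

    good-rooted n {inj₁ a} i j with ∈-map⁻ (loc a) j
    ... | _ , k , refl = loc i (good-terms n k)
    good-rooted n {inj₂ _} i (here refl) = good-∈As i

    -- `X` contains every good process still outside stage `n`. A newcomer `u` of the next stage
    -- lies in `X`, and what stays outside that stage is not above `u`, so the recursion descends
    -- along the accessibility of `X`.
    stabilise : ∀ {e k} n {X : Proc → Set} → WQ _⊑_ X →
      (∀ {P} → Good As P → ¬ Within e k n P → X P) →
      ∃ λ n → ∀ {P} → Good As P → Within e k (suc n) P → Within e k n P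
    stabilise {e} {k} n (wq f) covered
      with small-within {As} {e} {k} (suc n)
    ... | d , small
      with any? (λ u → within? e k (suc n) u ×-dec ¬? (within? e k n u)) (terms d)
    ...   | yes some =
      let (_ , i , w , ¬w) = find some
      in stabilise (suc n) (f (covered (good-terms d i) ¬w))
           (λ p ¬w′ → covered p (¬w′ ∘ inj₁) , λ d → ¬w′ (upward-within (suc n) p d w))
    ...   | no none = n , stable
      where
      stable : ∀ {P} → Good As P → Within e k (suc n) P → Within e k n P
      stable {P} p w with within? e k n P
      ... | yes w′ = w′
      ... | no ¬w =
        -- The small process below `P` is a newcomer too: if it were in stage `n`, upward closure
        -- would put `P` there. The search would have found it.
        let (_ , d′ , w′ , h) = small p w
        in ⊥-elim (none (lose (∈-terms d (good-⊑ d′ p) h)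
             (w′ , λ v → ¬w (upward-within n p d′ v))))

chain⇒within : ∀ {e k} n {P} → Chain e k P → Within e k n P
chain⇒within zero c = c
chain⇒within (suc n) c = inj₁ (chain⇒within n c)

-- A stationary stage is closed under predecessors, so it absorbs reduction sequences of any length,
-- from their end backwards.
weakBarb⇒within : ∀ {As e k n} → (∀ {P} → Good As P → Within e k (suc n) P → Within e k n P) →
  ∀ {P} → Good As P → WeakBarb P e k → Within e k n P
weakBarb⇒within {n = n} stable p (_ , ε , c) = chain⇒within n c
weakBarb⇒within stable p (_ , t ◅ ts , c) =
  stable p (inj₂ (_ , t , weakBarb⇒within stable (good-red (spec p t) p) (_ , ts , c)))

-- Embedding into extensions by arbitrarily many copies

Covers : (Proc → Set) → Proc → Set
Covers S u = ∃ λ P → S P × u ⊑ P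

data Padded (S : Proc → Set) (Q : Proc) : Proc → Set where
  base : ∀ {P} → S P → Padded S Q P
  pad  : ∀ {P} → Padded S Q P → Padded S Q (P ∥ Q)

module _ {S : Proc → Set} (S? : ∀ u → Dec (Covers S u)) (inhabited : ∃ S) (Q : Proc) where

  -- The number of copies is unbounded, but if `u` fits neither into the base nor into one `Q`, the
  -- outermost copy it uses takes its right component. The recursion continues on the left
  -- component.
  covers-padded? : ∀ u → Dec (Covers (Padded S Q) u)
  covers-padded? u with S? u | u ⊑? Q
  ... | yes (_ , s , d) | _ = yes (_ , base s , d)
  -- The copy of `Q` has to be attached to some base process.
  ... | no _ | yes d = yes (_ , pad (base (proj₂ inhabited)) , right d)
  ... | no ¬s | no ¬d = both u refl
    where
    split : ∀ {P} → Padded S Q P → u ⊑ P →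
            ∃ λ u₁ → ∃ λ u₂ → u ≡ u₁ ∥ u₂ × Covers (Padded S Q) u₁ × u₂ ⊑ Q
    split (base s) d = ⊥-elim (¬s (_ , s , d))
    split (pad x) (left d) = split x d
    split (pad x) (right d) = ⊥-elim (¬d d)
    split (pad x) (par d e) = _ , _ , refl , (_ , x , d) , e
    split (pad x) (leaf ())

    both : ∀ v → u ≡ v → Dec (Covers (Padded S Q) u)
    both (u₁ ∥ u₂) refl =
      map′ (λ ((_ , x , d) , e) → _ , pad x , par d e)
           (λ (_ , x , d) → case split x d of λ { (_ , _ , refl , c , e) → c , e })
           (covers-padded? u₁ ×-dec u₂ ⊑? Q)
    both hole refl = no λ (_ , x , d) → case split x d of λ ()
    both star refl = no λ (_ , x , d) → case split x d of λ ()
    both (loc _ _) refl = no λ (_ , x , d) → case split x d of λ ()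
    both (sum _) refl = no λ (_ , x , d) → case split x d of λ ()
    both (rep _ _) refl = no λ (_ , x , d) → case split x d of λ ()

parAll-++ : ∀ P Qs {Rs} → parAll P (Qs ++ Rs) ≡ parAll (parAll P Qs) Rs
parAll-++ P [] = refl
parAll-++ P (Q ∷ Qs) = parAll-++ (P ∥ Q) Qs

-- `parAll` peels copies off at the inside, `pad` at the outside; since the copies are equal, the
-- results coincide.
parAll-replicate : ∀ P m {Q} → parAll (P ∥ Q) (replicate m Q) ≡ parAll P (replicate m Q) ∥ Q
parAll-replicate P zero = refl
parAll-replicate P (suc m) {Q} = parAll-replicate (P ∥ Q) m

Extension : (Proc → Set) → List Proc → Proc → Set
Extension S M R = ∃ λ P → S P × InBC P M R

padded⇒ : ∀ {S Q P} → Padded S Q P → ∃ λ P₀ → S P₀ × ∃ λ m → P ≡ parAll P₀ (replicate m Q)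
padded⇒ (base s) = _ , s , 0 , refl
padded⇒ (pad {_} x) with padded⇒ x
... | _ , s , m , refl = _ , s , suc m , sym (parAll-replicate _ m)

⇒padded : ∀ {S Q P} m → S P → Padded S Q (parAll P (replicate m Q))
⇒padded zero s = base s
⇒padded {S} {Q} {P} (suc m) s =
  subst (Padded S Q) (sym (parAll-replicate P m)) (pad (⇒padded m s))

-- The base is a set rather than a single process, so that all paddings by one member of `M` can
-- serve as the base for the next.
covers-extension? : ∀ M {S} → (∀ u → Dec (Covers S u)) → ∃ S →
                    ∀ u → Dec (Covers (Extension S M) u)
covers-extension? [] S? _ u =
  map′ (λ (_ , s , d) → _ , (_ , s , (λ ()) , refl) , d)
       (λ { (_ , (_ , s , _ , refl) , d) → _ , s , d }) (S? u)
covers-extension? (Q ∷ M) {S} S? inhabited u =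
  map′ (λ (_ , x , d) → _ , from x , d) (λ (_ , x , d) → _ , to x , d)
    (covers-extension? M (covers-padded? S? inhabited Q) (_ , base (proj₂ inhabited)) u)
  where
  from : ∀ {R} → Extension (Padded S Q) M R → Extension S (Q ∷ M) R
  from (_ , x , ms , refl) with padded⇒ x
  ... | P , s , m , refl =
    P , s , (λ { zero → m ; (suc i) → ms i }) , sym (parAll-++ P (replicate m Q))

  to : ∀ {R} → Extension S (Q ∷ M) R → Extension (Padded S Q) M R
  to (P , s , ms , refl) = _ , ⇒padded (ms zero) s , ms ∘ suc , parAll-++ P (replicate (ms zero) Q)

-- The decision procedure

module _ {As : List Atom} where

  good-parAll : ∀ {P Qs} → Good As P → All (Good As) Qs → Good As (parAll P Qs)
  good-parAll p [] = p
  good-parAll p (q ∷ qs) = good-parAll (par p q) qs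

  good-copies : ∀ {M} → All (Good As) M → ∀ ms → All (Good As) (copies M ms)
  good-copies [] ms = []
  good-copies (q ∷ qs) ms = ++⁺ (replicate⁺ (ms zero) q) (good-copies qs (ms ∘ suc))

theorem7p24 : (P : Proc) → Ed2 P → (M : List Proc) → All Ed2 M →
    (e : Barb) → (k : ℕ) → 1 ≤ k →
    Dec (¬ (∃ λ R → InBC P M R × WeakBarb R e k))
theorem7p24 P p M ms e k _ = ¬? decide
  where
  As : List Atom
  As = concatMap atoms (P ∷ M)

  all-good : All (Good As) (P ∷ M)
  all-good = All.tabulate λ i →
    good (All.lookup (p ∷ ms) i) (λ j → ∈-concatMap⁺ atoms (lose i j))

  good-∈As : ∀ {l} → inj₂ l ∈ As → Good As l
  good-∈As i = let (_ , j , k) = find (∈-concatMap⁻ atoms {xs = P ∷ M} i)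
               in good-atom (All.lookup all-good j) k

  good-BC : ∀ {R} → InBC P M R → Good As R
  good-BC (ms , refl) = good-parAll (All.head all-good) (good-copies (All.tail all-good) ms)

  fixpoint : ∃ λ n → ∀ {P} → Good As P → Within e k (suc n) P → Within e k n P
  -- Initially nothing is known about stage 0, so `X` is the set of all good processes.
  fixpoint = stabilise As good-∈As 0 (wq-⊑ As) (λ p _ → p)

  n : ℕ
  n = proj₁ fixpoint

  d : ℕ
  d = proj₁ (small-within {As} {e} {k} n)

  covers? : ∀ u → Dec (Covers (InBC P M) u)
  covers? u =
    map′ (λ { (_ , (_ , refl , x) , d) → _ , x , d }) (λ (_ , x , d) → _ , (_ , refl , x) , d)
      (covers-extension? M {P ≡_}
        (λ u → map′ (λ d → _ , refl , d) (λ { (_ , refl , d) → d }) (u ⊑? P)) (P , refl) u)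

  decide : Dec (∃ λ R → InBC P M R × WeakBarb R e k)
  -- Some `R` of the family lies in the stationary stage exactly when some listed member `u` of that
  -- stage embeds into a process of the family: upward closure gives one direction, the weight bound
  -- the other.
  decide = map′
    (λ (some : Any (λ u → Within e k n u × Covers (InBC P M) u) (terms As d)) →
      let (_ , _ , w , R , x , d) = find some
      in R , x , within⇒weakBarb n (upward-within n (good-BC x) d w))
    (λ (R , x , b) →
      let r = good-BC x
          (_ , e , w , h) = proj₂ (small-within n) r (weakBarb⇒within (proj₂ fixpoint) r b)
      in lose (∈-terms As d (good-⊑ e r) h) (w , R , x , e))
    (any? (λ u → within? e k n u ×-dec covers? u) (terms As d))
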